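{- Let $\alpha\in(0,0.5)$, $k\in\mathbb N$, and let $r=\mathrm{poly}(k)$, i.e. $r=k^c$ for a constant $c\ge1$. Then there exists a $(k+2^r)\times r$ matrix $A$ such that $$\min_{\operatorname{rank}(\hat A)\le k}\|A-\hat A\|_{\infty,\infty}\le1$$ and for any $S\subseteq[r]$ with $|S|\le r/2$, $$\min_{X\in\mathbb R^{S\times r}}\|A-A|^S X\|_{\infty,\infty}\ge\Omega(k^{0.5-\alpha}).$$
   Context: $\|M\|_{\infty,\infty}=\max_{i,j}|M_{i,j}|$. $A|^S$ is the matrix formed by the columns of $A$ indexed by $S$; $\mathbb R^{S\times r}$ denotes matrices with rows indexed by $S$ and columns indexed by $[r]$. The constant hidden in $\Omega(\cdot)$ may depend on $\alpha$ and $c$ but not on $k$. -}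

module Defs where

open import Data.Fin.Base using (Fin; zero; suc)
open import Data.Fin.Subset using (Subset; inside; outside; ∣_∣)
open import Data.Integer.Base as ℤ using (+_)
open import Data.Nat.Base as ℕ using (ℕ; zero; suc; NonZero)
import Data.Nat.Properties as ℕP
open import Data.Product.Base using (∃; ∃-syntax; _×_; _,_)
open import Data.Rational.Base as ℚ using (ℚ; 0ℚ; 1ℚ; ½)
import Data.Rational.Properties as ℚP
open import Data.Rational.Solver using (module +-*-Solver)
open import Data.Sum.Base using ([_,_]′)
open import Data.Vec.Base using ([]; _∷_)
open import Data.Vec.Functional using (Vector; foldr)
open import Relation.Binary.PropositionalEquality
  using (_≡_; refl; sym; trans; cong; subst)

------------------------------------------------------------------------
-- Real numbers: Cauchy sequences of rationals.  Equality is _≈_, not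
-- propositional equality.

Cauchy : (ℕ → ℚ) → Set
Cauchy x = ∀ ε → 0ℚ ℚ.< ε →
  ∃[ N ] (∀ m n → N ℕ.≤ m → N ℕ.≤ n → ℚ.∣ x m ℚ.- x n ∣ ℚ.≤ ε)

record ℝ : Set where
  constructor mkℝ
  field
    seq    : ℕ → ℚ
    cauchy : Cauchy seq

open ℝ public

infix 4 _≈_ _≤_ _<_

_≈_ : ℝ → ℝ → Set
x ≈ y = ∀ ε → 0ℚ ℚ.< ε →
  ∃[ N ] (∀ n → N ℕ.≤ n → ℚ.∣ seq x n ℚ.- seq y n ∣ ℚ.≤ ε)

_≤_ : ℝ → ℝ → Set
x ≤ y = ∀ ε → 0ℚ ℚ.< ε →
  ∃[ N ] (∀ n → N ℕ.≤ n → seq x n ℚ.≤ seq y n ℚ.+ ε)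

_<_ : ℝ → ℝ → Set
x < y = ∃[ ε ] (0ℚ ℚ.< ε ×
  ∃[ N ] (∀ n → N ℕ.≤ n → seq x n ℚ.+ ε ℚ.≤ seq y n))

private
  close-≤ : ∀ p q {ε} → ℚ.∣ p ℚ.- q ∣ ℚ.≤ ε → p ℚ.≤ q ℚ.+ ε
  close-≤ p q {ε} h = subst (ℚ._≤ q ℚ.+ ε)
    (solve 2 (λ a b → b :+ (a :- b) := a) refl p q)
    (ℚP.+-monoʳ-≤ q (ℚP.≤-trans (p≤∣p∣ (p ℚ.- q)) h))
    where
    open +-*-Solver
    p≤∣p∣ : ∀ r → r ℚ.≤ ℚ.∣ r ∣
    p≤∣p∣ r = [ (λ 0≤r → ℚP.≤-reflexive (sym (ℚP.0≤p⇒∣p∣≡p 0≤r)))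
              , (λ r≤0 → ℚP.≤-trans r≤0 (ℚP.0≤∣p∣ r)) ]′ (ℚP.≤-total 0ℚ r)

  ∣-∣-comm : ∀ p q → ℚ.∣ p ℚ.- q ∣ ≡ ℚ.∣ q ℚ.- p ∣
  ∣-∣-comm p q = trans
    (cong ℚ.∣_∣ (solve 2 (λ a b → a :- b := :- (b :- a)) refl p q))
    (ℚP.∣-p∣≡∣p∣ (q ℚ.- p))
    where open +-*-Solver

  ≤-close : ∀ p q {ε} → p ℚ.≤ q ℚ.+ ε → q ℚ.≤ p ℚ.+ ε → ℚ.∣ p ℚ.- q ∣ ℚ.≤ ε
  ≤-close p q {ε} h₁ h₂ =
    [ (λ e → subst (ℚ._≤ ε) (sym e) (move p q h₁))
    , (λ e → subst (ℚ._≤ ε)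
        (sym (trans e (solve 2 (λ a b → :- (a :- b) := b :- a) refl p q)))
        (move q p h₂))
    ]′ (ℚP.∣p∣≡p∨∣p∣≡-p (p ℚ.- q))
    where
    open +-*-Solver
    move : ∀ a b → a ℚ.≤ b ℚ.+ ε → a ℚ.- b ℚ.≤ ε
    move a b h = subst (a ℚ.- b ℚ.≤_)
      (solve 2 (λ x e → (x :+ e) :- x := e) refl b ε)
      (ℚP.+-monoˡ-≤ (ℚ.- b) h)

  halve-pos : ∀ {ε} → 0ℚ ℚ.< ε → 0ℚ ℚ.< ½ ℚ.* ε
  halve-pos {ε} 0<ε =
    ℚP.positive⁻¹ (½ ℚ.* ε) {{ℚP.pos*pos⇒pos ½ ε {{ℚ.positive 0<ε}}}}

  halves : ∀ ε → ½ ℚ.* ε ℚ.+ ½ ℚ.* ε ≡ ε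
  halves ε = trans (sym (ℚP.*-distribʳ-+ ε ½ ½)) (ℚP.*-identityˡ ε)

------------------------------------------------------------------------
-- All operations act termwise on representing sequences.  The Cauchy proofs
-- are abstract because unfolding them makes type checking very slow.

abstract
  const-cauchy : ∀ p → Cauchy (λ _ → p)
  const-cauchy p ε 0<ε = 0 , λ _ _ _ _ →
    subst (λ z → ℚ.∣ z ∣ ℚ.≤ ε) (sym (ℚP.+-inverseʳ p)) (ℚP.<⇒≤ 0<ε)

fromℚ : ℚ → ℝ
fromℚ p = mkℝ (λ _ → p) (const-cauchy p)

fromℕ : ℕ → ℝ
fromℕ n = fromℚ (+ n ℚ./ 1)

0ℝ 1ℝ ½ℝ : ℝ
0ℝ = fromℚ 0ℚ
1ℝ = fromℚ 1ℚ
½ℝ = fromℚ ½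

infixl 6 _+_ _-_ _⊔_
infixl 7 _*_
infix  8 -_
infixr 8 _^_

abstract
  -‿cauchy : ∀ x → Cauchy (λ n → ℚ.- seq x n)
  -‿cauchy x ε 0<ε =
    let N , h = cauchy x ε 0<ε in
    N , λ m n N≤m N≤n → subst (ℚ._≤ ε) (sym (eq (seq x m) (seq x n))) (h m n N≤m N≤n)
    where
    open +-*-Solver
    eq : ∀ a b → ℚ.∣ (ℚ.- a) ℚ.- (ℚ.- b) ∣ ≡ ℚ.∣ a ℚ.- b ∣
    eq a b = trans
      (cong ℚ.∣_∣ (solve 2 (λ a b → (:- a) :- (:- b) := :- (a :- b)) refl a b))
      (ℚP.∣-p∣≡∣p∣ (a ℚ.- b))

-_ : ℝ → ℝ
- x = mkℝ (λ n → ℚ.- seq x n) (-‿cauchy x)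

abstract
  +-cauchy : ∀ x y → Cauchy (λ n → seq x n ℚ.+ seq y n)
  +-cauchy x y ε 0<ε =
    let N₁ , h₁ = cauchy x (½ ℚ.* ε) (halve-pos 0<ε)
        N₂ , h₂ = cauchy y (½ ℚ.* ε) (halve-pos 0<ε)
    in N₁ ℕ.⊔ N₂ , λ m n N≤m N≤n →
      bound ε (seq x m) (seq y m) (seq x n) (seq y n)
        (h₁ m n (ℕP.m⊔n≤o⇒m≤o N₁ N₂ N≤m) (ℕP.m⊔n≤o⇒m≤o N₁ N₂ N≤n))
        (h₂ m n (ℕP.m⊔n≤o⇒n≤o N₁ N₂ N≤m) (ℕP.m⊔n≤o⇒n≤o N₁ N₂ N≤n))
    where
    bound : ∀ ε a b c d → ℚ.∣ a ℚ.- c ∣ ℚ.≤ ½ ℚ.* ε → ℚ.∣ b ℚ.- d ∣ ℚ.≤ ½ ℚ.* ε →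
            ℚ.∣ (a ℚ.+ b) ℚ.- (c ℚ.+ d) ∣ ℚ.≤ ε
    bound ε a b c d h₁ h₂ = begin
      ℚ.∣ (a ℚ.+ b) ℚ.- (c ℚ.+ d) ∣
        ≡⟨ cong ℚ.∣_∣ (solve 4 (λ a b c d →
             (a :+ b) :- (c :+ d) := (a :- c) :+ (b :- d)) refl a b c d) ⟩
      ℚ.∣ (a ℚ.- c) ℚ.+ (b ℚ.- d) ∣
        ≤⟨ ℚP.∣p+q∣≤∣p∣+∣q∣ (a ℚ.- c) (b ℚ.- d) ⟩
      ℚ.∣ a ℚ.- c ∣ ℚ.+ ℚ.∣ b ℚ.- d ∣
        ≤⟨ ℚP.+-mono-≤ h₁ h₂ ⟩
      ½ ℚ.* ε ℚ.+ ½ ℚ.* ε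
        ≡⟨ halves ε ⟩
      ε ∎
      where
      open +-*-Solver
      open ℚP.≤-Reasoning

_+_ : ℝ → ℝ → ℝ
x + y = mkℝ (λ n → seq x n ℚ.+ seq y n) (+-cauchy x y)

_-_ : ℝ → ℝ → ℝ
x - y = x + (- y)

private
  eventually-bounded : ∀ x →
    ∃[ B ] (0ℚ ℚ.< B × ∃[ N ] (∀ n → N ℕ.≤ n → ℚ.∣ seq x n ∣ ℚ.≤ B))
  eventually-bounded x =
    let N , h = cauchy x 1ℚ (ℚP.positive⁻¹ 1ℚ)
        b = seq x N
    in 1ℚ ℚ.+ ℚ.∣ b ∣
     , ℚP.+-mono-<-≤ (ℚP.positive⁻¹ 1ℚ) (ℚP.0≤∣p∣ b)
     , N , λ n N≤n → bound (seq x n) b (h n N N≤n ℕP.≤-refl)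
    where
    bound : ∀ a b → ℚ.∣ a ℚ.- b ∣ ℚ.≤ 1ℚ → ℚ.∣ a ∣ ℚ.≤ 1ℚ ℚ.+ ℚ.∣ b ∣
    bound a b h = begin
      ℚ.∣ a ∣                        ≡⟨ cong ℚ.∣_∣ (solve 2 (λ a b →
                                          a := (a :- b) :+ b) refl a b) ⟩
      ℚ.∣ (a ℚ.- b) ℚ.+ b ∣          ≤⟨ ℚP.∣p+q∣≤∣p∣+∣q∣ (a ℚ.- b) b ⟩
      ℚ.∣ a ℚ.- b ∣ ℚ.+ ℚ.∣ b ∣      ≤⟨ ℚP.+-monoˡ-≤ ℚ.∣ b ∣ h ⟩
      1ℚ ℚ.+ ℚ.∣ b ∣                 ∎
      where
      open +-*-Solver
      open ℚP.≤-Reasoning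

  shrink : ∀ {ε B} → 0ℚ ℚ.< ε → 0ℚ ℚ.< B → ∃[ δ ] (0ℚ ℚ.< δ × B ℚ.* δ ≡ ε)
  shrink {ε} {B} 0<ε 0<B =
    ℚ.1/ B ℚ.* ε
    , ℚP.positive⁻¹ _ {{ℚP.pos*pos⇒pos (ℚ.1/ B) {{ℚP.1/pos⇒pos B}} ε}}
    , trans (sym (ℚP.*-assoc B (ℚ.1/ B) ε))
        (trans (cong (ℚ._* ε) (ℚP.*-inverseʳ B)) (ℚP.*-identityˡ ε))
    where
    instance
      B-pos : ℚ.Positive B
      B-pos = ℚ.positive 0<B
      B≢0 : ℚ.NonZero B
      B≢0 = ℚP.pos⇒nonZero B
      ε-pos : ℚ.Positive ε
      ε-pos = ℚ.positive 0<ε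

abstract
  *-cauchy : ∀ x y → Cauchy (λ n → seq x n ℚ.* seq y n)
  *-cauchy x y ε 0<ε =
    let B , 0<B , M₁ , bx = eventually-bounded x
        D , 0<D , M₂ , by = eventually-bounded y
        δ , 0<δ , eq = shrink 0<ε (ℚP.+-mono-< 0<B 0<D)
        N₁ , h₁ = cauchy x δ 0<δ
        N₂ , h₂ = cauchy y δ 0<δ
        N = (M₁ ℕ.⊔ M₂) ℕ.⊔ (N₁ ℕ.⊔ N₂)
        M₁≤ = λ {n} (N≤n : N ℕ.≤ n) →
          ℕP.m⊔n≤o⇒m≤o M₁ M₂ (ℕP.m⊔n≤o⇒m≤o (M₁ ℕ.⊔ M₂) (N₁ ℕ.⊔ N₂) N≤n)
        M₂≤ = λ {n} (N≤n : N ℕ.≤ n) →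
          ℕP.m⊔n≤o⇒n≤o M₁ M₂ (ℕP.m⊔n≤o⇒m≤o (M₁ ℕ.⊔ M₂) (N₁ ℕ.⊔ N₂) N≤n)
        N₁≤ = λ {n} (N≤n : N ℕ.≤ n) →
          ℕP.m⊔n≤o⇒m≤o N₁ N₂ (ℕP.m⊔n≤o⇒n≤o (M₁ ℕ.⊔ M₂) (N₁ ℕ.⊔ N₂) N≤n)
        N₂≤ = λ {n} (N≤n : N ℕ.≤ n) →
          ℕP.m⊔n≤o⇒n≤o N₁ N₂ (ℕP.m⊔n≤o⇒n≤o (M₁ ℕ.⊔ M₂) (N₁ ℕ.⊔ N₂) N≤n)
    in N , λ m n N≤m N≤n → subst (_ ℚ.≤_) eq
      (bound B D δ (seq x m) (seq y m) (seq x n) (seq y n) 0<δ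
        (bx m (M₁≤ N≤m)) (by n (M₂≤ N≤n))
        (h₁ m n (N₁≤ N≤m) (N₁≤ N≤n)) (h₂ m n (N₂≤ N≤m) (N₂≤ N≤n)))
    where
    bound : ∀ B D δ a b c d → 0ℚ ℚ.< δ → ℚ.∣ a ∣ ℚ.≤ B → ℚ.∣ d ∣ ℚ.≤ D →
            ℚ.∣ a ℚ.- c ∣ ℚ.≤ δ → ℚ.∣ b ℚ.- d ∣ ℚ.≤ δ →
            ℚ.∣ a ℚ.* b ℚ.- c ℚ.* d ∣ ℚ.≤ (B ℚ.+ D) ℚ.* δ
    bound B D δ a b c d 0<δ a≤B d≤D h₁ h₂ = begin
      ℚ.∣ a ℚ.* b ℚ.- c ℚ.* d ∣
        ≡⟨ cong ℚ.∣_∣ (solve 4 (λ a b c d →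
             a :* b :- c :* d := a :* (b :- d) :+ d :* (a :- c)) refl a b c d) ⟩
      ℚ.∣ a ℚ.* (b ℚ.- d) ℚ.+ d ℚ.* (a ℚ.- c) ∣
        ≤⟨ ℚP.∣p+q∣≤∣p∣+∣q∣ (a ℚ.* (b ℚ.- d)) (d ℚ.* (a ℚ.- c)) ⟩
      ℚ.∣ a ℚ.* (b ℚ.- d) ∣ ℚ.+ ℚ.∣ d ℚ.* (a ℚ.- c) ∣
        ≤⟨ ℚP.+-mono-≤ (prod a (b ℚ.- d) a≤B h₂) (prod d (a ℚ.- c) d≤D h₁) ⟩
      B ℚ.* δ ℚ.+ D ℚ.* δ
        ≡⟨ ℚP.*-distribʳ-+ δ B D ⟨
      (B ℚ.+ D) ℚ.* δ ∎
      where
      open +-*-Solver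
      open ℚP.≤-Reasoning
      instance
        δ-nonNeg : ℚ.NonNegative δ
        δ-nonNeg = ℚ.nonNegative (ℚP.<⇒≤ 0<δ)
      prod : ∀ u v {B} → ℚ.∣ u ∣ ℚ.≤ B → ℚ.∣ v ∣ ℚ.≤ δ → ℚ.∣ u ℚ.* v ∣ ℚ.≤ B ℚ.* δ
      prod u v {B} u≤B v≤δ = begin
        ℚ.∣ u ℚ.* v ∣       ≡⟨ ℚP.∣p*q∣≡∣p∣*∣q∣ u v ⟩
        ℚ.∣ u ∣ ℚ.* ℚ.∣ v ∣ ≤⟨ ℚP.*-monoˡ-≤-nonNeg ℚ.∣ u ∣ {{ℚ.nonNegative (ℚP.0≤∣p∣ u)}} v≤δ ⟩
        ℚ.∣ u ∣ ℚ.* δ       ≤⟨ ℚP.*-monoʳ-≤-nonNeg δ u≤B ⟩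
        B ℚ.* δ             ∎

_*_ : ℝ → ℝ → ℝ
x * y = mkℝ (λ n → seq x n ℚ.* seq y n) (*-cauchy x y)

abstract
  ⊔-cauchy : ∀ x y → Cauchy (λ n → seq x n ℚ.⊔ seq y n)
  ⊔-cauchy x y ε 0<ε =
    let N₁ , h₁ = cauchy x ε 0<ε
        N₂ , h₂ = cauchy y ε 0<ε
    in N₁ ℕ.⊔ N₂ , λ m n N≤m N≤n →
      bound ε (seq x m) (seq y m) (seq x n) (seq y n)
        (h₁ m n (ℕP.m⊔n≤o⇒m≤o N₁ N₂ N≤m) (ℕP.m⊔n≤o⇒m≤o N₁ N₂ N≤n))
        (h₂ m n (ℕP.m⊔n≤o⇒n≤o N₁ N₂ N≤m) (ℕP.m⊔n≤o⇒n≤o N₁ N₂ N≤n))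
    where
    half : ∀ ε a b c d → ℚ.∣ a ℚ.- c ∣ ℚ.≤ ε → ℚ.∣ b ℚ.- d ∣ ℚ.≤ ε →
           a ℚ.⊔ b ℚ.≤ (c ℚ.⊔ d) ℚ.+ ε
    half ε a b c d h₁ h₂ = ℚP.⊔-lub
      (ℚP.≤-trans (close-≤ a c h₁) (ℚP.+-monoˡ-≤ ε (ℚP.p≤p⊔q c d)))
      (ℚP.≤-trans (close-≤ b d h₂) (ℚP.+-monoˡ-≤ ε (ℚP.p≤q⊔p c d)))
    bound : ∀ ε a b c d → ℚ.∣ a ℚ.- c ∣ ℚ.≤ ε → ℚ.∣ b ℚ.- d ∣ ℚ.≤ ε →
            ℚ.∣ (a ℚ.⊔ b) ℚ.- (c ℚ.⊔ d) ∣ ℚ.≤ ε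
    bound ε a b c d h₁ h₂ = ≤-close (a ℚ.⊔ b) (c ℚ.⊔ d)
      (half ε a b c d h₁ h₂)
      (half ε c d a b (subst (ℚ._≤ ε) (∣-∣-comm a c) h₁)
                      (subst (ℚ._≤ ε) (∣-∣-comm b d) h₂))

_⊔_ : ℝ → ℝ → ℝ
x ⊔ y = mkℝ (λ n → seq x n ℚ.⊔ seq y n) (⊔-cauchy x y)

abs : ℝ → ℝ
abs x = x ⊔ (- x)

_^_ : ℝ → ℕ → ℝ
x ^ zero  = 1ℝ
x ^ suc n = x * x ^ n

-- y is the real power k ^ s of a natural base, for a real exponent s > 0:
-- the nonnegative y separating the numbers k ^ (p / q) (the q-th roots of
-- k ^ p) with 0 < p / q < s from those with p / q > s.  For s > 0 positive
-- rational exponents suffice to determine y, and they give 0 ^ s = 0.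
record IsPower (k : ℕ) (s y : ℝ) : Set where
  field
    nonneg : 0ℝ ≤ y
    lower  : ∀ p q .{{_ : NonZero p}} .{{_ : NonZero q}} →
             fromℚ (+ p ℚ./ q) < s → fromℕ (k ℕ.^ p) ≤ y ^ q
    upper  : ∀ p q .{{_ : NonZero p}} .{{_ : NonZero q}} →
             s < fromℚ (+ p ℚ./ q) → y ^ q ≤ fromℕ (k ℕ.^ p)

------------------------------------------------------------------------

Matrix : ℕ → ℕ → Set
Matrix m n = Fin m → Fin n → ℝ

private
  variable
    d k m n : ℕ

sum : Vector ℝ n → ℝ
sum = foldr _+_ 0ℝ

infixl 7 _*ᴹ_
infixl 6 _-ᴹ_

_*ᴹ_ : Matrix m k → Matrix k n → Matrix m n
(M *ᴹ N) i j = sum λ l → M i l * N l j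

_-ᴹ_ : Matrix m n → Matrix m n → Matrix m n
(M -ᴹ N) i j = M i j - N i j

-- The fold starts from 0, which is harmless for absolute values and gives
-- norm 0 to a matrix without entries.
maximum : Vector ℝ n → ℝ
maximum = foldr _⊔_ 0ℝ

‖_‖∞∞ : Matrix m n → ℝ
‖ M ‖∞∞ = maximum λ i → maximum λ j → abs (M i j)

-- The increasing enumeration of the elements of S.
enumerate : (S : Subset n) → Fin ∣ S ∣ → Fin n
enumerate (inside  ∷ S) zero    = zero
enumerate (inside  ∷ S) (suc i) = suc (enumerate S i)
enumerate (outside ∷ S) i       = suc (enumerate S i)

-- A matrix with rows indexed by S is identified, through this enumeration,
-- with a matrix with ∣ S ∣ rows.
infixl 8 _∣ᶜ_

_∣ᶜ_ : Matrix m n → (S : Subset n) → Matrix m ∣ S ∣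
(A ∣ᶜ S) i j = A i (enumerate S j)

combination : Vector ℝ d → Vector (Vector ℝ m) d → Vector ℝ m
combination x b i = sum λ l → x l * b l i

_∈Span_ : Vector ℝ m → Vector (Vector ℝ m) d → Set
_∈Span_ {d = d} v b = ∃ λ (x : Vector ℝ d) → ∀ i → v i ≈ combination x b i

Independent : Vector (Vector ℝ m) d → Set
Independent {d = d} b =
  (x : Vector ℝ d) → (∀ i → combination x b i ≈ 0ℝ) → ∀ l → x l ≈ 0ℝ

columns : Matrix m n → Vector (Vector ℝ m) n
columns M j i = M i j

-- The column space of M has a basis of d vectors.
record HasRank (M : Matrix m n) (d : ℕ) : Set where
  field
    basis         : Vector (Vector ℝ m) d
    basis⊆colSpan : ∀ l → basis l ∈Span columns M
    spanning      : ∀ j → columns M j ∈Span basis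
    independent   : Independent basis

rank_≤_ : Matrix m n → ℕ → Set
rank M ≤ k = ∃[ d ] (HasRank M d × d ℕ.≤ k)

{-# OPTIONS --safe #-}

-- The columns of A are of two kinds: their upper k entries are either a unit
-- vector e_a (a < p) or n times the indicator vector of the graph of a code
-- word of length n over q letters, p = nq; the lower 2^r rows run through all
-- sign vectors.  Dropping the signs leaves a matrix whose column space is
-- spanned by e_1, …, e_p.  As 2p < r, some code column c is not in S.  If E is
-- the error of approximating c by the columns in S with coefficients x, then
-- the sign rows force 1 + ‖x‖₁ ≤ E.  The upper entries of c on the graph of its
-- own word sum to n², those of any other column to at most nt if distinct code
-- words agree in at most t positions, so n² ≤ nE + nt‖x‖₁.  Hence n + 1 ≤ (t + 2)E.
-- A code with k^P words over q = 2nb letters, b a fixed small power of k, is found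
-- greedily with t independent of k, and n can be taken of order k^s for any
-- rational s < 1/2 of the form v/(2v + 2).

module Submission where

open import Algebra.Bundles using (CommutativeRing)
open import Data.Fin.Base using (Fin; zero; suc; _↑ˡ_; _↑ʳ_; splitAt; combine; remQuot; finToFun; funToFin)
open import Data.Fin.Properties using (splitAt⁻¹-↑ʳ; remQuot-combine; finToFun-funToFin)
open import Data.Fin.Subset using (Subset; inside; outside; ∣_∣; _∈_; _∉_)
open import Data.Fin.Subset.Properties using (∣p∣≤∣x∷p∣)
open import Data.Product.Base using (∃; ∃-syntax; _×_; _,_; proj₁; proj₂)
open import Data.Sum.Base using (_⊎_; inj₁; inj₂)
open import Data.Vec.Functional using (Vector; _++_)
open import Data.Vec.Functional.Properties using (lookup-++ˡ; lookup-++ʳ)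
open import Function.Base using (_∘_)
open import Relation.Binary.PropositionalEquality
open import Relation.Nullary using (contradiction; yes; no)

-- Finite sums over ℕ and codes whose words pairwise agree in few positions

module Words where

  open import Data.Nat.Base
  open import Data.Nat.Properties
  open import Data.Nat.Solver using (module +-*-Solver)
  open import Data.Vec.Functional using (_∷_)
  open import Algebra.Properties.Semiring.Sum +-*-semiring
    using (sum-cong-≗; *-distribˡ-sum; ∑-comm) renaming (sum to ∑)

  private variable n q R : ℕ

  -- Valued in ℕ so that it can be both an exponent, as in `∑-^δ`, and a count of agreements.
  δ : Fin n → Fin n → ℕ
  δ zero    zero    = 1
  δ zero    (suc _) = 0
  δ (suc _) zero    = 0
  δ (suc i) (suc j) = δ i j

  δ-refl : (i : Fin n) → δ i i ≡ 1
  δ-refl zero    = refl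
  δ-refl (suc i) = δ-refl i

  δ-sym : (i j : Fin n) → δ i j ≡ δ j i
  δ-sym zero    zero    = refl
  δ-sym zero    (suc _) = refl
  δ-sym (suc _) zero    = refl
  δ-sym (suc i) (suc j) = δ-sym i j

  δ≤1 : (i j : Fin n) → δ i j ≤ 1
  δ≤1 zero    zero    = ≤-refl
  δ≤1 zero    (suc _) = z≤n
  δ≤1 (suc _) zero    = z≤n
  δ≤1 (suc i) (suc j) = δ≤1 i j

  ∑-mono : {f g : Vector ℕ n} → (∀ i → f i ≤ g i) → ∑ f ≤ ∑ g
  ∑-mono {n = zero}  h = z≤n
  ∑-mono {n = suc n} h = +-mono-≤ (h zero) (∑-mono (h ∘ suc))

  ∑-const : ∀ n c → ∑ {n} (λ _ → c) ≡ n * c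
  ∑-const zero    c = refl
  ∑-const (suc n) c = cong (c +_) (∑-const n c)

  term≤∑ : (f : Vector ℕ n) (i : Fin n) → f i ≤ ∑ f
  term≤∑ f zero    = m≤m+n _ _
  term≤∑ f (suc i) = ≤-trans (term≤∑ (f ∘ suc) i) (m≤n+m _ _)

  ∃-min : .{{_ : NonZero n}} (f : Vector ℕ n) → ∃ λ a → ∀ b → f a ≤ f b
  ∃-min {n = suc zero}    f = zero , λ { zero → ≤-refl }
  ∃-min {n = suc (suc n)} f with ∃-min (f ∘ suc)
  ... | a , min with f zero ≤? f (suc a)
  ...   | yes le = zero  , λ { zero → ≤-refl ; (suc b) → ≤-trans le (min b) }
  ...   | no ¬le = suc a , λ { zero → <⇒≤ (≰⇒> ¬le) ; (suc b) → min b }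

  ∃-below-average : .{{_ : NonZero n}} (f : Vector ℕ n) → ∃ λ a → n * f a ≤ ∑ f
  ∃-below-average {n} f with ∃-min f
  ... | a , min = a , subst (_≤ ∑ f) (∑-const n (f a)) (∑-mono min)

  -- Exactly one letter matches `b` and has weight `1 + z`; each of the other `q - 1` letters has
  -- weight 1.
  ∑-^δ : ∀ z (b : Fin q) → ∑ (λ a → suc z ^ δ a b) ≡ q + z
  ∑-^δ {suc q} z zero = begin-equality
    suc z * 1 + ∑ {q} (λ _ → 1)  ≡⟨ cong₂ _+_ (*-identityʳ (suc z)) (trans (∑-const q 1) (*-identityʳ q)) ⟩
    suc z + q                    ≡⟨ cong suc (+-comm z q) ⟩
    suc q + z                    ∎
    where open ≤-Reasoning
  ∑-^δ z (suc b) = cong suc (∑-^δ z b)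

  agreement : (v w : Fin n → Fin q) → ℕ
  agreement v w = ∑ λ i → δ (v i) (w i)

  agreement-sym : (v w : Fin n → Fin q) → agreement v w ≡ agreement w v
  agreement-sym v w = sum-cong-≗ λ i → δ-sym (v i) (w i)

  -- Derandomised averaging: a uniformly random word w has
  -- E[(1+z)^agreement w v] = ((q+z)/q)^n for every v, and the letters of w are
  -- fixed one at a time without increasing the conditional expectation of the sum.
  ∃-spread-word : ∀ n z .{{_ : NonZero q}} (L : Fin R → Fin n → Fin q) (c : Vector ℕ R) →
    ∃ λ w → q ^ n * ∑ (λ l → c l * suc z ^ agreement w (L l)) ≤ (q + z) ^ n * ∑ c
  ∃-spread-word zero z L c =
    (λ ()) , ≤-reflexive (cong (1 *_) (sum-cong-≗ λ l → *-identityʳ (c l)))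
  ∃-spread-word {q} (suc n) z L c
    with a , a-good ← ∃-below-average {q} (λ a → ∑ λ l → c l * suc z ^ δ a (L l zero))
    with w , w-good ← ∃-spread-word n z (λ l → L l ∘ suc) (λ l → c l * suc z ^ δ a (L l zero))
    = a ∷ w , (begin
      q ^ suc n * ∑ (λ l → c l * suc z ^ (δ a (L l zero) + agreement w (L l ∘ suc)))
        ≡⟨ cong (q ^ suc n *_) (sum-cong-≗ λ l →
             trans (cong (c l *_) (^-distribˡ-+-* (suc z) (δ a (L l zero)) _))
                   (sym (*-assoc (c l) _ _))) ⟩
      q ^ suc n * ∑ (λ l → c′ l * suc z ^ agreement w (L l ∘ suc))
        ≡⟨ *-assoc q (q ^ n) _ ⟩
      q * (q ^ n * ∑ (λ l → c′ l * suc z ^ agreement w (L l ∘ suc)))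
        ≤⟨ *-monoʳ-≤ q w-good ⟩
      q * ((q + z) ^ n * ∑ c′)
        ≡⟨ solve 3 (λ x y s → x :* (y :* s) := y :* (x :* s)) refl q ((q + z) ^ n) (∑ c′) ⟩
      (q + z) ^ n * (q * ∑ c′)
        ≤⟨ *-monoʳ-≤ ((q + z) ^ n) a-good ⟩
      (q + z) ^ n * ∑ (λ a → ∑ λ l → c l * suc z ^ δ a (L l zero))
        ≡⟨ cong ((q + z) ^ n *_) (trans (∑-comm λ a l → c l * suc z ^ δ a (L l zero))
             (sum-cong-≗ λ l → trans (sym (*-distribˡ-sum (c l) (λ a → suc z ^ δ a (L l zero))))
                                      (cong (c l *_) (∑-^δ z (L l zero))))) ⟩
      (q + z) ^ n * ∑ (λ l → c l * (q + z))
        ≡⟨ cong ((q + z) ^ n *_) (trans (sum-cong-≗ λ l → *-comm (c l) (q + z))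
             (sym (*-distribˡ-sum (q + z) c))) ⟩
      (q + z) ^ n * ((q + z) * ∑ c)
        ≡⟨ solve 3 (λ x y s → y :* (x :* s) := x :* y :* s) refl (q + z) ((q + z) ^ n) (∑ c) ⟩
      (q + z) ^ suc n * ∑ c ∎)
    where
    open ≤-Reasoning
    open +-*-Solver
    c′ : Vector ℕ _
    c′ l = c l * suc z ^ δ a (L l zero)

  -- (1 + 1/N)^i ≤ N / (N − i), with N = i + j.
  bernoulli : ∀ N i j → i + j ≡ N → suc N ^ i * j ≤ N ^ i * N
  bernoulli N zero    j eq = *-monoʳ-≤ 1 (≤-reflexive eq)
  bernoulli N (suc i) j eq = begin
    suc N * suc N ^ i * j    ≡⟨ solve 3 (λ x y j → x :* y :* j := y :* (x :* j)) refl (suc N) (suc N ^ i) j ⟩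
    suc N ^ i * (suc N * j)  ≤⟨ *-monoʳ-≤ (suc N ^ i) step ⟩
    suc N ^ i * (N * suc j)  ≡⟨ solve 3 (λ x y j → y :* (x :* j) := x :* (y :* j)) refl N (suc N ^ i) (suc j) ⟩
    N * (suc N ^ i * suc j)  ≤⟨ *-monoʳ-≤ N (bernoulli N i (suc j) (trans (+-suc i j) eq)) ⟩
    N * (N ^ i * N)          ≡⟨ *-assoc N (N ^ i) N ⟨
    N * N ^ i * N            ∎
    where
    open ≤-Reasoning
    open +-*-Solver
    step : suc N * j ≤ N * suc j
    step = begin
      j + N * j  ≤⟨ +-monoˡ-≤ (N * j) (≤-trans (m≤n+m j (suc i)) (≤-reflexive eq)) ⟩
      N + N * j  ≡⟨ *-suc N j ⟨
      N * suc j  ∎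

  [mn]^o : ∀ m n o → (m * n) ^ o ≡ m ^ o * n ^ o
  [mn]^o m n zero    = refl
  [mn]^o m n (suc o) = trans (cong (m * n *_) ([mn]^o m n o))
    (solve 4 (λ m n x y → m :* n :* (x :* y) := m :* x :* (n :* y)) refl m n (m ^ o) (n ^ o))
    where open +-*-Solver

  -- After cancelling `z ^ n` this is (1 + 1/(2n))^n ≤ 2, the case N = 2n, i = j = n of `bernoulli`.
  -- It is the reason for the alphabet size `2 * n * z`: the expected weight in `∃-spread-word` is
  -- then at most 2.
  [2nz+z]^n≤2[2nz]^n : ∀ n z .{{_ : NonZero n}} → (2 * n * z + z) ^ n ≤ 2 * (2 * n * z) ^ n
  [2nz+z]^n≤2[2nz]^n n z = begin
    (2 * n * z + z) ^ n        ≡⟨ cong (_^ n) (+-comm (2 * n * z) z) ⟩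
    (suc (2 * n) * z) ^ n      ≡⟨ [mn]^o (suc (2 * n)) z n ⟩
    suc (2 * n) ^ n * z ^ n    ≤⟨ *-monoˡ-≤ (z ^ n) base ⟩
    2 * (2 * n) ^ n * z ^ n    ≡⟨ *-assoc 2 ((2 * n) ^ n) (z ^ n) ⟩
    2 * ((2 * n) ^ n * z ^ n)  ≡⟨ cong (2 *_) ([mn]^o (2 * n) z n) ⟨
    2 * (2 * n * z) ^ n        ∎
    where
    open ≤-Reasoning
    open +-*-Solver
    base : suc (2 * n) ^ n ≤ 2 * (2 * n) ^ n
    base = *-cancelʳ-≤ _ _ n (begin
      suc (2 * n) ^ n * n      ≤⟨ bernoulli (2 * n) n n (cong (n +_) (sym (+-identityʳ n))) ⟩
      (2 * n) ^ n * (2 * n)    ≡⟨ solve 2 (λ x n → x :* (con 2 :* n) := con 2 :* x :* n) refl ((2 * n) ^ n) n ⟩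
      2 * (2 * n) ^ n * n      ∎)

  -- Greedy extension: the word given by `∃-spread-word` with unit weights has total weight at most
  -- `2 * R` against the words already found, so a single agreement above `t` would by itself
  -- contribute too much.
  ∃-code : ∀ n z t R .{{_ : NonZero n}} .{{_ : NonZero z}} → 2 * R < suc z ^ suc t →
    ∃ λ (w : Fin R → Fin n → Fin (2 * n * z)) → ∀ i j → i ≢ j → agreement (w i) (w j) ≤ t
  ∃-code n z t zero    _ = (λ ()) , λ ()
  ∃-code n z t (suc R) h
    with w , w-far ← ∃-code n z t R (<-trans (*-monoʳ-< 2 (n<1+n R)) h)
    with v , v-good ← ∃-spread-word n z {{m*n≢0 (2 * n) z {{m*n≢0 2 n}}}} w (λ _ → 1)
    = v ∷ w , far
    where
    open ≤-Reasoning
    q₀ = 2 * n * z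
    instance
      q^n≢0 : NonZero (q₀ ^ n)
      q^n≢0 = m^n≢0 q₀ n {{m*n≢0 (2 * n) z {{m*n≢0 2 n}}}}
    v-far : ∀ l → agreement v (w l) ≤ t
    v-far l = ≮⇒≥ λ t<a → <⇒≱ h (*-cancelˡ-≤ (q₀ ^ n) (begin
      q₀ ^ n * suc z ^ suc t
        ≤⟨ *-monoʳ-≤ (q₀ ^ n) (^-monoʳ-≤ (suc z) t<a) ⟩
      q₀ ^ n * suc z ^ agreement v (w l)
        ≡⟨ cong (q₀ ^ n *_) (*-identityˡ _) ⟨
      q₀ ^ n * (1 * suc z ^ agreement v (w l))
        ≤⟨ *-monoʳ-≤ (q₀ ^ n) (term≤∑ (λ l → 1 * suc z ^ agreement v (w l)) l) ⟩
      q₀ ^ n * ∑ (λ l → 1 * suc z ^ agreement v (w l))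
        ≤⟨ v-good ⟩
      (q₀ + z) ^ n * ∑ {R} (λ _ → 1)
        ≤⟨ *-mono-≤ ([2nz+z]^n≤2[2nz]^n n z) (≤-reflexive (trans (∑-const R 1) (*-identityʳ R))) ⟩
      2 * q₀ ^ n * R
        ≡⟨ solve 2 (λ x r → con 2 :* x :* r := x :* (con 2 :* r)) refl (q₀ ^ n) R ⟩
      q₀ ^ n * (2 * R)
        ≤⟨ *-monoʳ-≤ (q₀ ^ n) (*-monoʳ-≤ 2 (n≤1+n R)) ⟩
      q₀ ^ n * (2 * suc R) ∎))
      where open +-*-Solver
    far : ∀ i j → i ≢ j → agreement ((v ∷ w) i) ((v ∷ w) j) ≤ t
    far zero    zero    i≢j = contradiction refl i≢j
    far zero    (suc j) i≢j = v-far j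
    far (suc i) zero    i≢j = subst (_≤ t) (agreement-sym v (w i)) (v-far i)
    far (suc i) (suc j) i≢j = w-far i j (i≢j ∘ cong suc)

  -- Choice of the integer parameters

  ∃-root : ∀ e .{{_ : NonZero e}} k → ∃ λ b → (4 * b) ^ e ≤ k × k < (4 * suc b) ^ e
  ∃-root e@(suc _) zero = 0 , z≤n , m^n>0 4 e
  ∃-root e (suc k) with ∃-root e k
  ... | b , lo , hi with suc k <? (4 * suc b) ^ e
  ...   | yes k< = b , ≤-trans lo (n≤1+n k) , k<
  -- The old strict upper bound on `k` is a weak one on `suc k`, so raising `b` by one restores the
  -- bracket.
  ...   | no  k≮ = suc b , ≮⇒≥ k≮ ,
    ≤-<-trans hi (^-monoˡ-< e (*-monoʳ-< 4 (n<1+n (suc b))))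

  -- Otherwise (1 + 1/r)^j ≤ r for every j, contradicting Bernoulli's inequality.
  k^j≤r^1+j⇒k≤r : ∀ k r → (∀ j .{{_ : NonZero j}} → k ^ j ≤ r ^ suc j) → k ≤ r
  k^j≤r^1+j⇒k≤r k zero h with k
  ... | zero  = z≤n
  ... | suc k = contradiction (h 1) (<⇒≱ (s≤s z≤n))
  k^j≤r^1+j⇒k≤r k r@(suc _) h = ≮⇒≥ λ r<k → <⇒≱ (n<1+n (r * r)) (begin
    j      ≤⟨ m≤n+m j r ⟩
    r + j  ≤⟨ *-cancelˡ-≤ (r ^ j) {{m^n≢0 r j}} (begin
      r ^ j * (r + j)    ≤⟨ growth j ⟩
      suc r ^ j * r      ≤⟨ *-monoˡ-≤ r (≤-trans (^-monoˡ-≤ j r<k) (h j)) ⟩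
      r * r ^ j * r      ≡⟨ solve 2 (λ r x → r :* x :* r := x :* (r :* r)) refl r (r ^ j) ⟩
      r ^ j * (r * r)    ∎) ⟩
    r * r  ∎)
    where
    open ≤-Reasoning
    open +-*-Solver
    j = suc (r * r)
    growth : ∀ j → r ^ j * (r + j) ≤ suc r ^ j * r
    growth zero    = ≤-reflexive (cong (1 *_) (+-identityʳ r))
    growth (suc j) = begin
      r * r ^ j * (r + suc j)       ≤⟨ m≤m+n _ (r ^ j * j) ⟩
      r * r ^ j * (r + suc j) + r ^ j * j
        ≡⟨ solve 3 (λ r x j → r :* x :* (r :+ (con 1 :+ j)) :+ x :* j := (con 1 :+ r) :* (x :* (r :+ j))) refl r (r ^ j) j ⟩
      suc r * (r ^ j * (r + j))     ≤⟨ *-monoʳ-≤ (suc r) (growth j) ⟩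
      suc r * (suc r ^ j * r)       ≡⟨ *-assoc (suc r) (suc r ^ j) r ⟨
      suc r ^ suc j * r             ∎

  -- For `b ≥ 1` this rests on 4(1 + b) ≤ 8b; the summand 1 keeps the right side large enough at
  -- `b = 0`.
  [4+4b]^v≤8^v[1+b^v] : ∀ v b → (4 * suc b) ^ v ≤ 8 ^ v * suc (b ^ v)
  [4+4b]^v≤8^v[1+b^v] v zero    = ≤-trans (^-monoˡ-≤ v (m≤m+n 4 4)) (m≤m*n (8 ^ v) (suc (0 ^ v)))
  [4+4b]^v≤8^v[1+b^v] v b@(suc b-1) = begin
    (4 * suc b) ^ v      ≤⟨ ^-monoˡ-≤ v 4[1+b]≤8b ⟩
    (8 * b) ^ v          ≡⟨ [mn]^o 8 b v ⟩
    8 ^ v * b ^ v        ≤⟨ *-monoʳ-≤ (8 ^ v) (n≤1+n (b ^ v)) ⟩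
    8 ^ v * suc (b ^ v)  ∎
    where
    open ≤-Reasoning
    open +-*-Solver
    4[1+b]≤8b : 4 * suc b ≤ 8 * b
    4[1+b]≤8b = ≤-trans (m≤m+n (4 * suc b) (4 * b-1))
      (≤-reflexive (solve 1 (λ x → con 4 :* (con 2 :+ x) :+ con 4 :* x := con 8 :* (con 1 :+ x)) refl b-1))

  -- On taking e-th roots: k^(v/e) is below 8^v (1 + n), where n = b^v is the word length. This
  -- turns an error of order n into a power of `k`.
  k^v<[8^v[1+b^v]]^e : ∀ v e .{{_ : NonZero v}} b {k} → k < (4 * suc b) ^ e → k ^ v < (8 ^ v * suc (b ^ v)) ^ e
  k^v<[8^v[1+b^v]]^e v e b {k} k< = begin-strict
    k ^ v                        <⟨ ^-monoˡ-< v k< ⟩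
    ((4 * suc b) ^ e) ^ v        ≡⟨ trans (^-*-assoc (4 * suc b) e v)
                                    (trans (cong ((4 * suc b) ^_) (*-comm e v))
                                           (sym (^-*-assoc (4 * suc b) v e))) ⟩
    ((4 * suc b) ^ v) ^ e        ≤⟨ ^-monoˡ-≤ e ([4+4b]^v≤8^v[1+b^v] v b) ⟩
    (8 ^ v * suc (b ^ v)) ^ e    ∎
    where open ≤-Reasoning

  -- With 4b about k^(1/(2v+2)), code words of length n = b^v over 2nb letters
  -- occupy fewer than k/2 rows, and n is of order k^(v/(2v+2)).
  dimension : ℕ → ℕ → ℕ
  dimension v b = b ^ v * (2 * b ^ v * b)

  -- The left side is 4 b^(2v+1), while `k` is at least 4^(2v+2) b^(2v+2). The bound lets the unit
  -- columns take up less than half of all columns.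
  2dimension<k : ∀ v .{{_ : NonZero v}} b {k} → 0 < k → (4 * b) ^ (2 * suc v) ≤ k →
    2 * dimension v b < k
  2dimension<k (suc _) zero 0<k _ = 0<k
  2dimension<k v b@(suc _) {k} _ h = <-≤-trans (begin-strict
    2 * (b ^ v * (2 * b ^ v * b))
      ≡⟨ solve 2 (λ x b → con 2 :* (x :* (con 2 :* x :* b)) := con 4 :* (x :* x :* b)) refl (b ^ v) b ⟩
    4 * u
      <⟨ *-monoˡ-< u {{m*n≢0 (b ^ v * b ^ v) b {{m*n≢0 (b ^ v) (b ^ v) {{m^n≢0 b v}} {{m^n≢0 b v}}}}}} (m≤m+n 5 11) ⟩
    16 * u
      ≤⟨ *-monoˡ-≤ u (m≤m*n 16 (4 ^ v * 4 ^ v) {{m*n≢0 (4 ^ v) (4 ^ v) {{m^n≢0 4 v}} {{m^n≢0 4 v}}}}) ⟩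
    16 * (4 ^ v * 4 ^ v) * u
      ≤⟨ m≤m*n _ b ⟩
    16 * (4 ^ v * 4 ^ v) * u * b
      ≡⟨ solve 3 (λ y x b → con 16 :* (y :* y) :* (x :* x :* b) :* b
                          := ((con 4 :* b) :* (y :* x)) :* ((con 4 :* b) :* (y :* x))) refl (4 ^ v) (b ^ v) b ⟩
    ((4 * b) * (4 ^ v * b ^ v)) * ((4 * b) * (4 ^ v * b ^ v))
      ≡⟨ cong (λ z → ((4 * b) * z) * ((4 * b) * z)) ([mn]^o 4 b v) ⟨
    (4 * b) ^ suc v * (4 * b) ^ suc v
      ≡⟨ ^-distribˡ-+-* (4 * b) (suc v) (suc v) ⟨
    (4 * b) ^ (suc v + suc v)
      ≡⟨ cong (λ z → (4 * b) ^ (suc v + z)) (+-identityʳ (suc v)) ⟨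
    (4 * b) ^ (2 * suc v) ∎) h
    where
    open ≤-Reasoning
    open +-*-Solver
    u = b ^ v * b ^ v * b

  -- Since `b ≥ 1`, 4(1 + b) ≤ (1 + b)³, so `k ^ P` is at most a power of `1 + b` with an exponent
  -- free of `k`. Two further factors `1 + b ≥ 2` absorb the 2 strictly.
  2R<[1+b]^ : ∀ e P b {k R} .{{_ : NonZero b}} → k < (4 * suc b) ^ e → R ≤ k ^ P →
    2 * R < suc b ^ (2 + 3 * e * P)
  2R<[1+b]^ e P b@(suc b-1) {k} {R} k< R≤ = begin-strict
    2 * R                  ≤⟨ *-monoʳ-≤ 2 R≤X ⟩
    2 * X                  <⟨ *-monoˡ-< X {{m^n≢0 (suc b) (3 * e * P)}} (m≤m+n 3 1) ⟩
    2 * 2 * X              ≤⟨ *-monoˡ-≤ X (*-mono-≤ 2≤1+b 2≤1+b) ⟩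
    suc b * suc b * X      ≡⟨ *-assoc (suc b) (suc b) X ⟩
    suc b * (suc b * X)    ∎
    where
    open ≤-Reasoning
    open +-*-Solver
    X = suc b ^ (3 * e * P)
    2≤1+b : 2 ≤ suc b
    2≤1+b = s≤s (s≤s z≤n)
    R≤X : R ≤ X
    R≤X = begin
      R                          ≤⟨ R≤ ⟩
      k ^ P                      ≤⟨ ^-monoˡ-≤ P (<⇒≤ k<) ⟩
      ((4 * suc b) ^ e) ^ P      ≤⟨ ^-monoˡ-≤ P (^-monoˡ-≤ e 4[1+b]≤[1+b]³) ⟩
      ((suc b ^ 3) ^ e) ^ P      ≡⟨ trans (cong (_^ P) (^-*-assoc (suc b) 3 e)) (^-*-assoc (suc b) (3 * e) P) ⟩
      X                          ∎
      where
      4[1+b]≤[1+b]³ : 4 * suc b ≤ suc b ^ 3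
      4[1+b]≤[1+b]³ = begin
        2 * 2 * suc b            ≤⟨ *-monoˡ-≤ (suc b) (*-mono-≤ 2≤1+b 2≤1+b) ⟩
        suc b * suc b * suc b    ≡⟨ solve 1 (λ c → c :* c :* c := c :* (c :* (c :* con 1))) refl (suc b) ⟩
        suc b ^ 3                ∎

  ∃-code-for : ∀ v .{{_ : NonZero v}} e P b {k R} → k < (4 * suc b) ^ e → R ≤ k ^ P →
    ∃ λ (w : Fin R → Fin (b ^ v) → Fin (2 * b ^ v * b)) → ∀ i j → i ≢ j → agreement (w i) (w j) ≤ 1 + 3 * e * P
  -- Here the length `0 ^ v` is 0: all words are empty and agree nowhere.
  ∃-code-for (suc _) e P zero    _  _  = (λ _ ()) , λ _ _ _ → z≤n
  ∃-code-for v       e P b@(suc _) {R = R} k< R≤ =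
    ∃-code (b ^ v) b (1 + 3 * e * P) R {{m^n≢0 b v}} (2R<[1+b]^ e P b k< R≤)

-- The embedding of ℕ in ℚ

module Embedding where

  open import Data.Nat.Base as ℕ using (ℕ; suc)
  import Data.Nat.Properties as ℕP
  open import Data.Integer.Base as ℤ using (+_)
  import Data.Integer.Properties as ℤP
  open import Data.Rational.Base
  open import Data.Rational.Properties
  import Data.Rational.Unnormalised.Base as ℚᵘ
  import Data.Rational.Unnormalised.Properties as ℚᵘP

  toℚᵘ-/ : ∀ m d .{{_ : ℕ.NonZero d}} → toℚᵘ (+ m / d) ℚᵘ.≃ (+ m) ℚᵘ./ d
  toℚᵘ-/ m (suc d) = toℚᵘ-fromℚᵘ (ℚᵘ.mkℚᵘ (+ m) d)

  -- Abstract because unfolding the normalisation of + n / 1 makes type checking very slow.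
  abstract
    ι : ℕ → ℚ
    ι n = + n / 1

    ι-def : ∀ n → ι n ≡ + n / 1
    ι-def n = refl

    ι-0 : ι 0 ≡ 0ℚ
    ι-0 = refl

    ι-1 : ι 1 ≡ 1ℚ
    ι-1 = refl

    ι-+ : ∀ m n → ι (m ℕ.+ n) ≡ ι m + ι n
    ι-+ m n = toℚᵘ-injective (begin-equality
      toℚᵘ (ι (m ℕ.+ n))            ≃⟨ toℚᵘ-/ (m ℕ.+ n) 1 ⟩
      + (m ℕ.+ n) ℚᵘ./ 1            ≃⟨ ℚᵘ.*≡* (cong (ℤ._* (+ 1)) (cong₂ ℤ._+_
                                         (sym (ℤP.*-identityʳ (+ m))) (sym (ℤP.*-identityʳ (+ n))))) ⟩
      + m ℚᵘ./ 1 ℚᵘ.+ + n ℚᵘ./ 1    ≃⟨ ℚᵘP.+-cong (toℚᵘ-/ m 1) (toℚᵘ-/ n 1) ⟨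
      toℚᵘ (ι m) ℚᵘ.+ toℚᵘ (ι n)    ≃⟨ toℚᵘ-homo-+ (ι m) (ι n) ⟨
      toℚᵘ (ι m + ι n)              ∎)
      where open ℚᵘP.≤-Reasoning

    ι-* : ∀ m n → ι (m ℕ.* n) ≡ ι m * ι n
    ι-* m n = toℚᵘ-injective (begin-equality
      toℚᵘ (ι (m ℕ.* n))            ≃⟨ toℚᵘ-/ (m ℕ.* n) 1 ⟩
      + (m ℕ.* n) ℚᵘ./ 1            ≃⟨ ℚᵘ.*≡* (cong (ℤ._* (+ 1)) (ℤP.pos-* m n)) ⟩
      (+ m ℚᵘ./ 1) ℚᵘ.* (+ n ℚᵘ./ 1)  ≃⟨ ℚᵘP.*-cong (toℚᵘ-/ m 1) (toℚᵘ-/ n 1) ⟨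
      toℚᵘ (ι m) ℚᵘ.* toℚᵘ (ι n)    ≃⟨ toℚᵘ-homo-* (ι m) (ι n) ⟨
      toℚᵘ (ι m * ι n)              ∎)
      where open ℚᵘP.≤-Reasoning

    ι-mono-≤ : ∀ {m n} → m ℕ.≤ n → ι m ≤ ι n
    ι-mono-≤ {m} {n} m≤n = toℚᵘ-cancel-≤ (begin
      toℚᵘ (ι m)  ≃⟨ toℚᵘ-/ m 1 ⟩
      + m ℚᵘ./ 1  ≤⟨ ℚᵘ.*≤* (ℤP.*-monoʳ-≤-nonNeg (+ 1) (ℤ.+≤+ m≤n)) ⟩
      + n ℚᵘ./ 1  ≃⟨ toℚᵘ-/ n 1 ⟨
      toℚᵘ (ι n)  ∎)
      where open ℚᵘP.≤-Reasoning

    ι-mono-< : ∀ {m n} → m ℕ.< n → ι m < ι n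
    ι-mono-< {m} {n} m<n = toℚᵘ-cancel-< (begin-strict
      toℚᵘ (ι m)  ≃⟨ toℚᵘ-/ m 1 ⟩
      + m ℚᵘ./ 1  <⟨ ℚᵘ.*<* (ℤP.*-monoʳ-<-pos (+ 1) (ℤ.+<+ m<n)) ⟩
      + n ℚᵘ./ 1  ≃⟨ toℚᵘ-/ n 1 ⟨
      toℚᵘ (ι n)  ∎)
      where open ℚᵘP.≤-Reasoning

    *-/-cancel : ∀ m d .{{_ : ℕ.NonZero d}} → ι d * (+ m / d) ≡ ι m
    *-/-cancel m d@(suc _) = toℚᵘ-injective (begin-equality
      toℚᵘ (ι d * (+ m / d))            ≃⟨ toℚᵘ-homo-* (ι d) (+ m / d) ⟩
      toℚᵘ (ι d) ℚᵘ.* toℚᵘ (+ m / d)    ≃⟨ ℚᵘP.*-cong (toℚᵘ-/ d 1) (toℚᵘ-/ m d) ⟩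
      (+ d ℚᵘ./ 1) ℚᵘ.* (+ m ℚᵘ./ d)    ≃⟨ ℚᵘ.*≡* (trans (ℤP.*-identityʳ _)
                                           (trans (ℤP.*-comm (+ d) (+ m)) (cong (λ x → + m ℤ.* + x) (sym (ℕP.*-identityˡ d))))) ⟩
      + m ℚᵘ./ 1                        ≃⟨ toℚᵘ-/ m 1 ⟨
      toℚᵘ (ι m)                        ∎)
      where open ℚᵘP.≤-Reasoning

-- Sums, signs and subsets over ℚ

module Rationals where

  open Words
  open Embedding
  open import Data.Nat.Base as ℕ using (ℕ; zero; suc; z≤n; s≤s)
  import Data.Nat.Properties as ℕP
  open import Data.Rational.Base as ℚ hiding (∣_∣)
  open import Data.Rational.Properties
  open import Data.Rational.Solver using (module +-*-Solver)
  open import Data.Vec.Base using (_∷_; here; there)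
  open import Defs using (enumerate)
  import Algebra.Properties.Semiring.Sum ℕP.+-*-semiring as ℕΣ
  open import Algebra.Properties.Semiring.Sum (CommutativeRing.semiring +-*-commutativeRing)
    using (sum; sum-cong-≗; *-distribˡ-sum; *-distribʳ-sum; ∑-comm; ∑-distrib-+)

  private variable d n q r : ℕ

  sum-mono : {f g : Vector ℚ n} → (∀ i → f i ≤ g i) → sum f ≤ sum g
  sum-mono {n = zero}  h = ≤-refl
  sum-mono {n = suc n} h = +-mono-≤ (h zero) (sum-mono (h ∘ suc))

  ι-sum : (f : Vector ℕ n) → ι (ℕΣ.sum f) ≡ sum (ι ∘ f)
  ι-sum {zero}  f = ι-0
  ι-sum {suc n} f = trans (ι-+ (f zero) _) (cong (ι (f zero) +_) (ι-sum (f ∘ suc)))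

  ι-suc : ∀ n → ι (suc n) ≡ 1ℚ + ι n
  ι-suc n = trans (ι-+ 1 n) (cong (_+ ι n) ι-1)

  sum-const : ∀ n c → sum {n} (λ _ → c) ≡ ι n * c
  sum-const zero    c = sym (trans (cong (_* c) ι-0) (*-zeroˡ c))
  sum-const (suc n) c = begin-equality
    c + sum {n} (λ _ → c)  ≡⟨ cong (c +_) (sum-const n c) ⟩
    c + ι n * c            ≡⟨ solve 2 (λ c x → c :+ x :* c := (con 1ℚ :+ x) :* c) refl c (ι n) ⟩
    (1ℚ + ι n) * c         ≡⟨ cong (_* c) (ι-suc n) ⟨
    ι (suc n) * c          ∎
    where
    open ≤-Reasoning
    open +-*-Solver

  sum-0 : ∀ n → sum {n} (λ _ → 0ℚ) ≡ 0ℚ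
  sum-0 n = trans (sum-const n 0ℚ) (*-zeroʳ (ι n))

  sum-δ : (f : Vector ℚ n) (i : Fin n) → sum (λ l → f l * ι (δ i l)) ≡ f i
  sum-δ {suc n} f zero = begin-equality
    f zero * ι 1 + sum (λ l → f (suc l) * ι 0)
      ≡⟨ cong₂ _+_ (trans (cong (f zero *_) ι-1) (*-identityʳ (f zero)))
           (sum-cong-≗ {n} λ l → trans (cong (f (suc l) *_) ι-0) (*-zeroʳ (f (suc l)))) ⟩
    f zero + sum {n} (λ _ → 0ℚ)
      ≡⟨ cong (f zero +_) (sum-0 n) ⟩
    f zero + 0ℚ
      ≡⟨ +-identityʳ (f zero) ⟩
    f zero ∎
    where open ≤-Reasoning
  sum-δ f (suc i) = trans
    (cong₂ _+_ (trans (cong (f zero *_) ι-0) (*-zeroʳ (f zero))) (sum-δ (f ∘ suc) i))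
    (+-identityˡ (f (suc i)))

  0≤ι : ∀ n → 0ℚ ≤ ι n
  0≤ι n = subst (_≤ ι n) ι-0 (ι-mono-≤ z≤n)

  p≤∣p∣ : ∀ p → p ≤ ℚ.∣ p ∣
  p≤∣p∣ p with ≤-total 0ℚ p
  ... | inj₁ 0≤p = ≤-reflexive (sym (0≤p⇒∣p∣≡p 0≤p))
  ... | inj₂ p≤0 = ≤-trans p≤0 (0≤∣p∣ p)

  -- Signs are coded by `Fin 2` so that `finToFun` lists all sign vectors by an index below a power
  -- of 2.
  sgn : Fin 2 → ℚ
  sgn zero    = 1ℚ
  sgn (suc _) = - 1ℚ

  -- The case `p = 0` falls to the sign `+1`; `hard-bound` relies on this at the omitted column,
  -- whose coefficient is 0.
  opposite-sign : ℚ → Fin 2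
  opposite-sign p with p ≤? 0ℚ
  ... | yes _ = zero
  ... | no  _ = suc zero

  sgn-opposite-sign : ∀ p → sgn (opposite-sign p) * p ≡ - ℚ.∣ p ∣
  sgn-opposite-sign p with p ≤? 0ℚ
  ... | yes p≤0 = begin-equality
    1ℚ * p         ≡⟨ solve 1 (λ p → con 1ℚ :* p := :- (:- p)) refl p ⟩
    - (- p)        ≡⟨ cong -_ (0≤p⇒∣p∣≡p (neg-antimono-≤ p≤0)) ⟨
    - ℚ.∣ - p ∣    ≡⟨ cong -_ (∣-p∣≡∣p∣ p) ⟩
    - ℚ.∣ p ∣      ∎
    where
    open ≤-Reasoning
    open +-*-Solver
  ... | no p≰0 = begin-equality
    - 1ℚ * p       ≡⟨ solve 1 (λ p → (:- con 1ℚ) :* p := :- p) refl p ⟩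
    - p            ≡⟨ cong -_ (0≤p⇒∣p∣≡p (<⇒≤ (≰⇒> p≰0))) ⟨
    - ℚ.∣ p ∣      ∎
    where
    open ≤-Reasoning
    open +-*-Solver

  -- Extension by zero, so that a sign row over all columns can be read off from coefficients given
  -- only on `S`.
  extend : (S : Subset n) → Vector ℚ ∣ S ∣ → Vector ℚ n
  extend (inside  ∷ S) x zero    = x zero
  extend (inside  ∷ S) x (suc j) = extend S (x ∘ suc) j
  extend (outside ∷ S) x zero    = 0ℚ
  extend (outside ∷ S) x (suc j) = extend S x j

  extend-enumerate : (S : Subset n) (x : Vector ℚ ∣ S ∣) → ∀ l → extend S x (enumerate S l) ≡ x l
  extend-enumerate (inside  ∷ S) x zero    = refl
  extend-enumerate (inside  ∷ S) x (suc l) = extend-enumerate S (x ∘ suc) l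
  extend-enumerate (outside ∷ S) x l       = extend-enumerate S x l

  extend-∉ : (S : Subset n) (x : Vector ℚ ∣ S ∣) → ∀ {j} → j ∉ S → extend S x j ≡ 0ℚ
  extend-∉ (inside  ∷ S) x {zero}  j∉S = contradiction here j∉S
  extend-∉ (inside  ∷ S) x {suc j} j∉S = extend-∉ S (x ∘ suc) (j∉S ∘ there)
  extend-∉ (outside ∷ S) x {zero}  j∉S = refl
  extend-∉ (outside ∷ S) x {suc j} j∉S = extend-∉ S x (j∉S ∘ there)

  enumerate-∈ : (S : Subset n) → ∀ l → enumerate S l ∈ S
  enumerate-∈ (inside  ∷ S) zero    = here
  enumerate-∈ (inside  ∷ S) (suc l) = there (enumerate-∈ S l)
  enumerate-∈ (outside ∷ S) l       = there (enumerate-∈ S l)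

  -- Pigeonhole: discarding the first `p` positions does not raise the count, and it is too small to
  -- fill the other `n`.
  ∃-∉ : ∀ p (S : Subset (p ℕ.+ n)) → ∣ S ∣ ℕ.< n → ∃ λ j → p ↑ʳ j ∉ S
  ∃-∉ (suc p) (x ∷ S) h with ∃-∉ p S (ℕP.≤-<-trans (∣p∣≤∣x∷p∣ x S) h)
  ... | j , j∉S = j , λ { (there j∈S) → j∉S j∈S }
  ∃-∉ {suc n} zero (outside ∷ S) h = zero , λ ()
  ∃-∉ {suc n} zero (inside ∷ S) (s≤s h) with ∃-∉ zero S h
  ... | j , j∉S = suc j , λ { (there j∈S) → j∉S j∈S }

  -- If X is the ℓ₁-norm of x, the signed rows give 1 + X ≤ E, and averaging the
  -- n other rows gives n ≤ E + t X.
  combined-bound : ∀ n t E (x : Vector ℚ d) (T : Fin n → Fin d → ℕ) →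
    (∀ l → ℕΣ.sum (λ i → T i l) ℕ.≤ n ℕ.* t) →
    (∀ i → ι n - sum (λ l → ι (T i l) * x l) ≤ E) →
    1ℚ + sum (λ l → ℚ.∣ x l ∣) ≤ E →
    ι (suc n) ≤ ι (2 ℕ.+ t) * E
  combined-bound {d} n t E x T T-small top signs = begin
    ι (suc n)                      ≡⟨ ι-suc n ⟩
    1ℚ + ι n                       ≤⟨ +-mono-≤ 1≤E (≤-trans (n≤ n T T-small top) (+-monoʳ-≤ E tX≤tE)) ⟩
    E + (E + ι t * E)              ≡⟨ solve 2 (λ e t → e :+ (e :+ t :* e) := (con 1ℚ :+ (con 1ℚ :+ t)) :* e) refl E (ι t) ⟩
    (1ℚ + (1ℚ + ι t)) * E          ≡⟨ cong (_* E) (trans (ι-suc (suc t)) (cong (1ℚ +_) (ι-suc t))) ⟨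
    ι (2 ℕ.+ t) * E                ∎
    where
    open ≤-Reasoning
    open +-*-Solver
    X : ℚ
    X = sum (λ l → ℚ.∣ x l ∣)
    0≤X : 0ℚ ≤ X
    0≤X = begin
      0ℚ                   ≡⟨ sum-0 d ⟨
      sum {d} (λ _ → 0ℚ)   ≤⟨ sum-mono {d} (λ l → 0≤∣p∣ (x l)) ⟩
      X                    ∎
    1≤E : 1ℚ ≤ E
    1≤E = ≤-trans (subst (_≤ 1ℚ + X) (+-identityʳ 1ℚ) (+-monoʳ-≤ 1ℚ 0≤X)) signs
    X≤E : X ≤ E
    X≤E = ≤-trans (subst (_≤ 1ℚ + X) (+-identityˡ X) (+-monoˡ-≤ X (<⇒≤ (positive⁻¹ 1ℚ)))) signs
    tX≤tE : ι t * X ≤ ι t * E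
    tX≤tE = *-monoˡ-≤-nonNeg (ι t) {{nonNegative (0≤ι t)}} X≤E
    n≤ : ∀ n (T : Fin n → Fin d → ℕ) → (∀ l → ℕΣ.sum (λ i → T i l) ℕ.≤ n ℕ.* t) →
         (∀ i → ι n - sum (λ l → ι (T i l) * x l) ≤ E) → ι n ≤ E + ι t * X
    n≤ zero T _ _ = begin
      ι 0            ≡⟨ ι-0 ⟩
      0ℚ + 0ℚ        ≡⟨ cong (0ℚ +_) (*-zeroʳ (ι t)) ⟨
      0ℚ + ι t * 0ℚ  ≤⟨ +-mono-≤ (≤-trans (<⇒≤ (positive⁻¹ 1ℚ)) 1≤E)
                         (*-monoˡ-≤-nonNeg (ι t) {{nonNegative (0≤ι t)}} 0≤X) ⟩
      E + ι t * X    ∎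
    n≤ N@(suc n-1) T T-small top =
      *-cancelˡ-≤-pos (ι N) {{positive (subst (_< ι N) ι-0 (ι-mono-< {0} {N} (s≤s z≤n)))}} (begin
      ι N * ι N
        ≡⟨ sum-const N (ι N) ⟨
      sum {N} (λ _ → ι N)
        ≤⟨ sum-mono {N} row ⟩
      sum (λ i → E + sum (λ l → ι (T i l) * ℚ.∣ x l ∣))
        ≡⟨ ∑-distrib-+ {N} (λ _ → E) (λ i → sum (λ l → ι (T i l) * ℚ.∣ x l ∣)) ⟩
      sum {N} (λ _ → E) + sum (λ i → sum (λ l → ι (T i l) * ℚ.∣ x l ∣))
        ≡⟨ cong₂ _+_ (sum-const N E) (trans (∑-comm {N} {d} λ i l → ι (T i l) * ℚ.∣ x l ∣) (sum-cong-≗ {d} column)) ⟩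
      ι N * E + sum (λ l → ι (ℕΣ.sum (λ i → T i l)) * ℚ.∣ x l ∣)
        ≤⟨ +-monoʳ-≤ (ι N * E) (sum-mono {d} λ l →
             *-monoʳ-≤-nonNeg ℚ.∣ x l ∣ {{∣-∣-nonNeg (x l)}} (ι-mono-≤ (T-small l))) ⟩
      ι N * E + sum (λ l → ι (N ℕ.* t) * ℚ.∣ x l ∣)
        ≡⟨ cong (ι N * E +_) (*-distribˡ-sum (ι (N ℕ.* t)) (λ l → ℚ.∣ x l ∣)) ⟨
      ι N * E + ι (N ℕ.* t) * X
        ≡⟨ cong (λ y → ι N * E + y * X) (ι-* N t) ⟩
      ι N * E + ι N * ι t * X
        ≡⟨ solve 4 (λ n e t x → n :* e :+ n :* t :* x := n :* (e :+ t :* x)) refl (ι N) E (ι t) X ⟩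
      ι N * (E + ι t * X) ∎)
      where
      column : ∀ l → sum (λ i → ι (T i l) * ℚ.∣ x l ∣) ≡ ι (ℕΣ.sum (λ i → T i l)) * ℚ.∣ x l ∣
      column l = trans (sym (*-distribʳ-sum ℚ.∣ x l ∣ (λ i → ι (T i l))))
                       (cong (_* ℚ.∣ x l ∣) (sym (ι-sum λ i → T i l)))
      row : ∀ i → ι N ≤ E + sum (λ l → ι (T i l) * ℚ.∣ x l ∣)
      row i = begin
        ι N
          ≡⟨ solve 2 (λ n s → n := (n :- s) :+ s) refl (ι N) (sum (λ l → ι (T i l) * x l)) ⟩
        (ι N - sum (λ l → ι (T i l) * x l)) + sum (λ l → ι (T i l) * x l)
          ≤⟨ +-mono-≤ (top i) (sum-mono {d} λ l →
               *-monoˡ-≤-nonNeg (ι (T i l)) {{nonNegative (0≤ι (T i l))}} (p≤∣p∣ (x l))) ⟩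
        E + sum (λ l → ι (T i l) * ℚ.∣ x l ∣) ∎

  -- The hard matrix and its error bound over ℚ

  module _ (w : Fin r → Fin n → Fin q) where

    -- `remQuot` reads a row as a pair of a position and a letter, so the second block consists of
    -- `n` times the indicators of the graphs of the words; the first block is an identity matrix.
    top : Fin (n ℕ.* q) → Vector ℕ (n ℕ.* q ℕ.+ r)
    top a = δ a ++ λ j → n ℕ.* δ (w j (proj₁ (remQuot {n} q a))) (proj₂ (remQuot {n} q a))

    -- Here `k` counts only the zero rows, which pad the `n * q` graph rows up to the prescribed
    -- size.
    topRows : ∀ k → Fin (n ℕ.* q ℕ.+ k) → Vector ℚ (n ℕ.* q ℕ.+ r)
    topRows k = (λ a → ι ∘ top a) ++ λ _ _ → 0ℚ

    hard approximant : ∀ k → Fin (n ℕ.* q ℕ.+ k ℕ.+ 2 ℕ.^ (n ℕ.* q ℕ.+ r)) → Vector ℚ (n ℕ.* q ℕ.+ r)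
    hard        k = topRows k ++ λ s → sgn ∘ finToFun s
    approximant k = topRows k ++ λ _ _ → 0ℚ

    hard-top : ∀ k a c → hard k ((a ↑ˡ k) ↑ˡ _) c ≡ ι (top a c)
    hard-top k a c = trans (cong (λ v → v c) (lookup-++ˡ (topRows k) _ (a ↑ˡ k)))
                           (cong (λ v → v c) (lookup-++ˡ (λ a → ι ∘ top a) _ a))

    hard-signs : ∀ k (σ : Fin (n ℕ.* q ℕ.+ r) → Fin 2) c → hard k ((n ℕ.* q ℕ.+ k) ↑ʳ funToFin σ) c ≡ sgn (σ c)
    hard-signs k σ c = trans (cong (λ v → v c) (lookup-++ʳ (topRows k) _ (funToFin σ)))
                             (cong sgn (finToFun-funToFin σ c))

    testRow : Fin r → Fin n → Fin (n ℕ.* q)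
    testRow j i = combine i (w j i)

    top-testRow : ∀ j i j′ → top (testRow j i) ((n ℕ.* q) ↑ʳ j′) ≡ n ℕ.* δ (w j′ i) (w j i)
    top-testRow j i j′ = trans
      (lookup-++ʳ (δ (testRow j i)) _ j′)
      (cong (λ ab → n ℕ.* δ (w j′ (proj₁ ab)) (proj₂ ab)) (remQuot-combine {n} i (w j i)))

    -- A code column sums to `n` times its agreement with `w j`. A unit column has entries at most
    -- 1, which is where `1 ≤ t` enters.
    testRow-sum : ∀ {t} → 1 ℕ.≤ t → (∀ i j → i ≢ j → agreement (w i) (w j) ℕ.≤ t) →
      ∀ j c → c ≢ (n ℕ.* q) ↑ʳ j → ℕΣ.sum (λ i → top (testRow j i) c) ℕ.≤ n ℕ.* t
    testRow-sum {t} 1≤t far j c c≢ with splitAt (n ℕ.* q) c in eq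
    ... | inj₁ b = begin
      ℕΣ.sum (λ i → δ (testRow j i) b)  ≤⟨ ∑-mono {n} (λ i → ℕP.≤-trans (δ≤1 (testRow j i) b) 1≤t) ⟩
      ℕΣ.sum {n} (λ i → t)              ≡⟨ ∑-const n t ⟩
      n ℕ.* t                           ∎
      where open ℕP.≤-Reasoning
    ... | inj₂ j′ = begin
      ℕΣ.sum (λ i → n ℕ.* δ (w j′ (proj₁ (remQuot {n} q (testRow j i)))) (proj₂ (remQuot {n} q (testRow j i))))
        ≡⟨ ℕΣ.sum-cong-≗ {n} (λ i → cong (λ ab → n ℕ.* δ (w j′ (proj₁ ab)) (proj₂ ab))
             (remQuot-combine {n} i (w j i))) ⟩
      ℕΣ.sum (λ i → n ℕ.* δ (w j′ i) (w j i))
        ≡⟨ ℕΣ.*-distribˡ-sum n (λ i → δ (w j′ i) (w j i)) ⟨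
      n ℕ.* agreement (w j′) (w j)
        ≤⟨ ℕP.*-monoʳ-≤ n (far j′ j λ { refl → c≢ (sym (splitAt⁻¹-↑ʳ eq)) }) ⟩
      n ℕ.* t ∎
      where open ℕP.≤-Reasoning

    -- Some code column `c` is outside `S`. The rows on the graph of its word and the one sign row
    -- opposing the coefficients `x l c` supply the two inputs of `combined-bound`.
    hard-bound : ∀ k {t} → 1 ℕ.≤ t → (∀ i j → i ≢ j → agreement (w i) (w j) ℕ.≤ t) →
      (S : Subset (n ℕ.* q ℕ.+ r)) → ∣ S ∣ ℕ.< r → (x : Fin ∣ S ∣ → Vector ℚ (n ℕ.* q ℕ.+ r)) → ∀ E →
      (∀ i c → hard k i c - sum (λ l → hard k i (enumerate S l) * x l c) ≤ E) →
      ι (suc n) ≤ ι (2 ℕ.+ t) * E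
    hard-bound k {t} 1≤t far S ∣S∣<r x E err≤E
      with j , j∉S ← ∃-∉ (n ℕ.* q) S ∣S∣<r =
      combined-bound n t E xⱼ (λ i l → top (testRow j i) (enumerate S l))
        (λ l → testRow-sum 1≤t far j _ (λ eq → j∉S (subst (_∈ S) eq (enumerate-∈ S l))))
        (λ i → ≤-trans (≤-reflexive (sym (cong₂ _-_
            (trans (hard-top k (testRow j i) c) (cong ι (trans (top-testRow j i j)
              (trans (cong (n ℕ.*_) (δ-refl (w j i))) (ℕP.*-identityʳ n)))))
            (sum-cong-≗ {∣ S ∣} λ l → cong (_* xⱼ l) (hard-top k (testRow j i) (enumerate S l))))))
          (err≤E _ c))
        (≤-trans (≤-reflexive (sym signs)) (err≤E _ c))
      where
      c = (n ℕ.* q) ↑ʳ j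
      xⱼ : Vector ℚ ∣ S ∣
      xⱼ l = x l c
      σ : Fin (n ℕ.* q ℕ.+ r) → Fin 2
      σ = opposite-sign ∘ extend S xⱼ
      row = (n ℕ.* q ℕ.+ k) ↑ʳ funToFin σ
      open ≤-Reasoning
      signs : hard k row c - sum (λ l → hard k row (enumerate S l) * xⱼ l) ≡ 1ℚ + sum (λ l → ℚ.∣ xⱼ l ∣)
      -- The extended coefficient at `c` is 0, so the entry there is `+1`; on `S` each product is
      -- minus an absolute value, and subtraction turns these into the ℓ₁-norm.
      signs = cong₂ _+_
        (trans (hard-signs k σ c) (cong (sgn ∘ opposite-sign) (extend-∉ S xⱼ j∉S)))
        (begin-equality
          - sum (λ l → hard k row (enumerate S l) * xⱼ l)
            ≡⟨ cong -_ (sum-cong-≗ {∣ S ∣} term) ⟩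
          - sum (λ l → - 1ℚ * ℚ.∣ xⱼ l ∣)
            ≡⟨ cong -_ (*-distribˡ-sum (- 1ℚ) (λ l → ℚ.∣ xⱼ l ∣)) ⟨
          - (- 1ℚ * sum (λ l → ℚ.∣ xⱼ l ∣))
            ≡⟨ solve 1 (λ s → :- ((:- con 1ℚ) :* s) := s) refl (sum (λ l → ℚ.∣ xⱼ l ∣)) ⟩
          sum (λ l → ℚ.∣ xⱼ l ∣) ∎)
        where
        open +-*-Solver
        term : ∀ l → hard k row (enumerate S l) * xⱼ l ≡ - 1ℚ * ℚ.∣ xⱼ l ∣
        term l = begin-equality
          hard k row (enumerate S l) * xⱼ l
            ≡⟨ cong (_* xⱼ l) (trans (hard-signs k σ (enumerate S l))
                 (cong (sgn ∘ opposite-sign) (extend-enumerate S xⱼ l))) ⟩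
          sgn (opposite-sign (xⱼ l)) * xⱼ l
            ≡⟨ sgn-opposite-sign (xⱼ l) ⟩
          - ℚ.∣ xⱼ l ∣
            ≡⟨ solve 1 (λ s → :- s := (:- con 1ℚ) :* s) refl ℚ.∣ xⱼ l ∣ ⟩
          - 1ℚ * ℚ.∣ xⱼ l ∣ ∎

-- From termwise rational estimates to Cauchy reals

open Words
open Embedding
open Rationals
open import Data.Nat.Base as ℕ using (ℕ; zero; suc; z≤n; s≤s; NonZero)
import Data.Nat.Properties as ℕP
open import Data.Integer.Base as ℤ using (+_; +0; +[1+_]; -[1+_])
open import Data.Rational.Base as ℚ using (ℚ; 0ℚ; 1ℚ; ½; mkℚ)
import Data.Rational.Properties as ℚP
open import Data.Rational.Solver using (module +-*-Solver)
open import Algebra.Properties.Semiring.Sum (CommutativeRing.semiring ℚP.+-*-commutativeRing)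
  using (sum-cong-≗) renaming (sum to ∑ℚ)
open import Defs

private variable m n q r : ℕ

seq-sum : (f : Vector ℝ n) → ∀ N → seq (sum f) N ≡ ∑ℚ λ i → seq (f i) N
seq-sum {zero}  f N = refl
seq-sum {suc n} f N = cong (seq (f zero) N ℚ.+_) (seq-sum (f ∘ suc) N)

term≤maximum : (f : Vector ℝ n) → ∀ N i → seq (f i) N ℚ.≤ seq (maximum f) N
term≤maximum f N zero    = ℚP.p≤p⊔q _ _
term≤maximum f N (suc i) = ℚP.≤-trans (term≤maximum (f ∘ suc) N i) (ℚP.p≤q⊔p (seq (f zero) N) _)

0≤maximum : (f : Vector ℝ n) → ∀ N → 0ℚ ℚ.≤ seq (maximum f) N
0≤maximum {zero}  f N = ℚP.≤-refl
0≤maximum {suc n} f N = ℚP.≤-trans (0≤maximum (f ∘ suc) N) (ℚP.p≤q⊔p (seq (f zero) N) _)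

maximum-lub : (f : Vector ℝ n) → ∀ N {b} → 0ℚ ℚ.≤ b → (∀ i → seq (f i) N ℚ.≤ b) → seq (maximum f) N ℚ.≤ b
maximum-lub {zero}  f N 0≤b h = 0≤b
maximum-lub {suc n} f N 0≤b h = ℚP.⊔-lub (h zero) (maximum-lub (f ∘ suc) N 0≤b (h ∘ suc))

entry≤norm : (M : Matrix m n) → ∀ N i j → seq (M i j) N ℚ.≤ seq ‖ M ‖∞∞ N
entry≤norm M N i j = ℚP.≤-trans (ℚP.p≤p⊔q _ _)
  (ℚP.≤-trans (term≤maximum (λ j → abs (M i j)) N j) (term≤maximum (λ i → maximum λ j → abs (M i j)) N i))

0≤norm : (M : Matrix m n) → ∀ N → 0ℚ ℚ.≤ seq ‖ M ‖∞∞ N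
0≤norm M = 0≤maximum λ i → maximum λ j → abs (M i j)

seq-≤ : ∀ {x y} → (∀ N → seq x N ℚ.≤ seq y N) → x ≤ y
seq-≤ {x} {y} h ε 0<ε = 0 , λ N _ → ℚP.≤-trans (h N)
  (subst (ℚ._≤ seq y N ℚ.+ ε) (ℚP.+-identityʳ (seq y N)) (ℚP.+-monoʳ-≤ (seq y N) (ℚP.<⇒≤ 0<ε)))

seq-≈ : ∀ {x y} → (∀ N → seq x N ≡ seq y N) → x ≈ y
seq-≈ {x} {y} h ε 0<ε = 0 , λ N _ → subst (ℚ._≤ ε)
  (sym (trans (cong (λ z → ℚ.∣ z ℚ.- seq y N ∣) (h N)) (cong ℚ.∣_∣ (ℚP.+-inverseʳ (seq y N)))))
  (ℚP.<⇒≤ 0<ε)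

≈-respˡ-seq : ∀ {x y z} → (∀ N → seq x N ≡ seq y N) → x ≈ z → y ≈ z
≈-respˡ-seq {z = z} h x≈z ε 0<ε with x≈z ε 0<ε
... | N , close = N , λ n N≤n → subst (λ s → ℚ.∣ s ℚ.- seq z n ∣ ℚ.≤ ε) (h n) (close n N≤n)

fromℚᴹ : (Fin m → Fin n → ℚ) → Matrix m n
fromℚᴹ B i j = fromℚ (B i j)

-- The approximant and the lower bound for real coefficients

module _ (w : Fin r → Fin n → Fin q) (k : ℕ) where

  private
    B̂ = approximant w k
    p+r = n ℕ.* q ℕ.+ r

  approximant-row : ∀ i → (∃ λ a → ∀ c → B̂ i c ≡ ι (top w a c)) ⊎ (∀ c → B̂ i c ≡ 0ℚ)
  approximant-row i with splitAt (n ℕ.* q ℕ.+ k) i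
  ... | inj₂ _ = inj₂ λ _ → refl
  ... | inj₁ i′ with splitAt (n ℕ.* q) i′
  ...   | inj₁ a = inj₁ (a , λ _ → refl)
  ...   | inj₂ _ = inj₂ λ _ → refl

  approximant-top : ∀ a c → B̂ ((a ↑ˡ k) ↑ˡ _) c ≡ ι (top w a c)
  approximant-top a c = trans
    (cong (λ v → v c) (lookup-++ˡ (topRows w k) _ (a ↑ˡ k)))
    (cong (λ v → v c) (lookup-++ˡ (λ a → ι ∘ top w a) _ a))

  top-unit : ∀ a l → top w a (l ↑ˡ r) ≡ δ a l
  top-unit a l = lookup-++ˡ (δ a) _ l

  -- An upper row restricts to a unit vector on the first `n * q` columns, so the coefficients of
  -- column `c` are its own upper entries; the remaining rows vanish.
  approximant-expand : ∀ i c → B̂ i c ≡ ∑ℚ λ l → ι (top w l c) ℚ.* B̂ i (l ↑ˡ r)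
  approximant-expand i c with approximant-row i
  ... | inj₁ (a , row) = sym (trans
    (sum-cong-≗ {n ℕ.* q} λ l → cong (ι (top w l c) ℚ.*_) (trans (row (l ↑ˡ r)) (cong ι (top-unit a l))))
    (trans (sum-δ (λ l → ι (top w l c)) a) (sym (row c))))
  ... | inj₂ row = sym (trans
    (sum-cong-≗ {n ℕ.* q} λ l → trans (cong (ι (top w l c) ℚ.*_) (row (l ↑ˡ r))) (ℚP.*-zeroʳ (ι (top w l c))))
    (trans (sum-0 (n ℕ.* q)) (sym (row c))))

  approximant-rank : HasRank (fromℚᴹ B̂) (n ℕ.* q)
  approximant-rank = record
    { basis         = basis
    ; basis⊆colSpan = λ l → (λ c → fromℚ (ι (δ (l ↑ˡ r) c))) , λ i →
        seq-≈ {basis l i} {combination (λ c → fromℚ (ι (δ (l ↑ˡ r) c))) (columns (fromℚᴹ B̂)) i} λ N → sym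
        (trans (seq-sum (λ c → fromℚ (ι (δ (l ↑ˡ r) c)) * fromℚ (B̂ i c)) N)
        (trans (sum-cong-≗ {p+r} λ c → ℚP.*-comm (ι (δ (l ↑ˡ r) c)) (B̂ i c)) (sum-δ (B̂ i) (l ↑ˡ r))))
    ; spanning      = λ c → (λ l → fromℚ (ι (top w l c))) , λ i →
        seq-≈ {fromℚ (B̂ i c)} {combination (λ l → fromℚ (ι (top w l c))) basis i} λ N →
        trans (approximant-expand i c) (sym (seq-sum (λ l → fromℚ (ι (top w l c)) * basis l i) N))
    -- Row `l` meets the basis in the identity block and isolates the coefficient `x l`.
    ; independent   = λ x x≈0 l → ≈-respˡ-seq {combination x basis ((l ↑ˡ k) ↑ˡ _)} {x l} {0ℝ} (λ N →
        trans (seq-sum (λ l′ → x l′ * basis l′ ((l ↑ˡ k) ↑ˡ _)) N)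
        (trans (sum-cong-≗ {n ℕ.* q} λ l′ → cong (seq (x l′) N ℚ.*_)
                 (trans (approximant-top l (l′ ↑ˡ r)) (cong ι (top-unit l l′))))
               (sum-δ (λ l′ → seq (x l′) N) l)))
        (x≈0 ((l ↑ˡ k) ↑ˡ _))
    }
    where
    basis : Vector (Vector ℝ _) (n ℕ.* q)
    basis l i = fromℚ (B̂ i (l ↑ˡ r))

  approximant-error : ∀ i c → let e = hard w k i c ℚ.- B̂ i c in e ℚ.⊔ (ℚ.- e) ℚ.≤ 1ℚ
  approximant-error i c with splitAt (n ℕ.* q ℕ.+ k) i
  ... | inj₁ i′ = subst (λ e → e ℚ.⊔ (ℚ.- e) ℚ.≤ 1ℚ) (sym (ℚP.+-inverseʳ (topRows w k i′ c)))
      (ℚP.<⇒≤ (ℚP.positive⁻¹ 1ℚ))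
  ... | inj₂ s with finToFun {n = p+r} s c
  ...   | zero  = ℚP.≤-refl
  ...   | suc _ = ℚP.≤-refl

  approximant-norm : ‖ fromℚᴹ (hard w k) -ᴹ fromℚᴹ B̂ ‖∞∞ ≤ 1ℝ
  approximant-norm = seq-≤ {‖ M ‖∞∞} {1ℝ} λ N →
    maximum-lub (λ i → maximum λ c → abs (M i c)) N 0≤1 λ i →
    maximum-lub (λ c → abs (M i c)) N 0≤1 λ c → approximant-error i c
    where
    M = fromℚᴹ (hard w k) -ᴹ fromℚᴹ B̂
    0≤1 = ℚP.<⇒≤ (ℚP.positive⁻¹ 1ℚ)

  -- `A` is constant in the index, so at each `N` the terms of `X` are rational coefficients and
  -- `hard-bound` applies with the same constant.
  hard-norm : ∀ {t} → 1 ℕ.≤ t → (∀ i j → i ≢ j → agreement (w i) (w j) ℕ.≤ t) →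
    (S : Subset p+r) → ∣ S ∣ ℕ.< r → (X : Matrix ∣ S ∣ p+r) → ∀ N →
    let A = fromℚᴹ (hard w k) in
    ι (suc n) ℚ.≤ ι (2 ℕ.+ t) ℚ.* seq ‖ A -ᴹ (A ∣ᶜ S) *ᴹ X ‖∞∞ N
  hard-norm 1≤t far S ∣S∣<r X N = hard-bound w k 1≤t far S ∣S∣<r (λ l c → seq (X l c) N) _
    λ i c → subst (ℚ._≤ seq ‖ A -ᴹ (A ∣ᶜ S) *ᴹ X ‖∞∞ N)
      (cong (λ s → hard w k i c ℚ.- s) (seq-sum (λ l → (A ∣ᶜ S) i l * X l c) N))
      (entry≤norm (A -ᴹ (A ∣ᶜ S) *ᴹ X) N i c)
    where A = fromℚᴹ (hard w k)

-- Powers, roots and rational exponents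

0<1ℚ : 0ℚ ℚ.< 1ℚ
0<1ℚ = ℚP.positive⁻¹ 1ℚ

0<ι : ∀ n .{{_ : NonZero n}} → 0ℚ ℚ.< ι n
0<ι (suc n) = subst (ℚ._< ι (suc n)) ι-0 (ι-mono-< (s≤s z≤n))

0<* : ∀ {p q} → 0ℚ ℚ.< p → 0ℚ ℚ.< q → 0ℚ ℚ.< p ℚ.* q
0<* {p} {q} 0<p 0<q = ℚP.positive⁻¹ (p ℚ.* q) {{ℚP.pos*pos⇒pos p {{ℚ.positive 0<p}} q {{ℚ.positive 0<q}}}}

0</ : ∀ m d .{{_ : NonZero m}} .{{_ : NonZero d}} → 0ℚ ℚ.< + m ℚ./ d
0</ m d = ℚP.*-cancelˡ-<-nonNeg (ι d) {{ℚ.nonNegative (0≤ι d)}}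
  (subst₂ ℚ._<_ (sym (ℚP.*-zeroʳ (ι d))) (sym (*-/-cancel m d)) (0<ι m))

cancel-ι : ∀ d .{{_ : NonZero d}} {p q} → ι d ℚ.* p ℚ.≤ ι d ℚ.* q → p ℚ.≤ q
cancel-ι d = ℚP.*-cancelˡ-≤-pos (ι d) {{ℚ.positive (0<ι d)}}

≤-cancel-ι : ∀ {x y m n} → (∀ N → seq x N ≡ ι m) → (∀ N → seq y N ≡ ι n) → x ≤ y → m ℕ.≤ n
-- Distinct naturals differ by at least 1, so the precision `½` already separates them.
≤-cancel-ι {x} {y} {m} {n} x≡ y≡ x≤y with x≤y ½ (ℚP.positive⁻¹ ½)
... | N , h = ℕP.≮⇒≥ λ n<m → ℚP.<-irrefl refl (begin-strict
  ι m              ≡⟨ x≡ N ⟨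
  seq x N          ≤⟨ h N ℕP.≤-refl ⟩
  seq y N ℚ.+ ½    ≡⟨ cong (ℚ._+ ½) (y≡ N) ⟩
  ι n ℚ.+ ½        <⟨ ℚP.+-monoʳ-< (ι n) {½} {1ℚ} (ℚ.*<* (ℤ.+<+ (s≤s (s≤s z≤n)))) ⟩
  ι n ℚ.+ 1ℚ       ≡⟨ ℚP.+-comm (ι n) 1ℚ ⟩
  1ℚ ℚ.+ ι n       ≡⟨ ι-suc n ⟨
  ι (suc n)        ≤⟨ ι-mono-≤ n<m ⟩
  ι m              ∎)
  where open ℚP.≤-Reasoning

pow : ℚ → ℕ → ℚ
pow p zero    = 1ℚ
pow p (suc n) = p ℚ.* pow p n

seq-^ : ∀ x n N → seq (x ^ n) N ≡ pow (seq x N) n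
seq-^ x zero    N = refl
seq-^ x (suc n) N = cong (seq x N ℚ.*_) (seq-^ x n N)

pow-ι : ∀ m n → pow (ι m) n ≡ ι (m ℕ.^ n)
pow-ι m zero    = sym ι-1
pow-ι m (suc n) = trans (cong (ι m ℚ.*_) (pow-ι m n)) (sym (ι-* m (m ℕ.^ n)))

pow-pos : ∀ {p} n → 0ℚ ℚ.< p → 0ℚ ℚ.< pow p n
pow-pos zero    0<p = 0<1ℚ
pow-pos (suc n) 0<p = 0<* 0<p (pow-pos n 0<p)

pow-mono-≤ : ∀ {p q} n → 0ℚ ℚ.≤ p → p ℚ.< q → pow p n ℚ.≤ pow q n
pow-mono-< : ∀ {p q} n .{{_ : NonZero n}} → 0ℚ ℚ.≤ p → p ℚ.< q → pow p n ℚ.< pow q n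
pow-mono-< {p} {q} (suc n) 0≤p p<q = begin-strict
  p ℚ.* pow p n  ≤⟨ ℚP.*-monoˡ-≤-nonNeg p {{ℚ.nonNegative 0≤p}} (pow-mono-≤ n 0≤p p<q) ⟩
  p ℚ.* pow q n  <⟨ ℚP.*-monoˡ-<-pos (pow q n) {{ℚ.positive (pow-pos n (ℚP.≤-<-trans 0≤p p<q))}} p<q ⟩
  q ℚ.* pow q n  ∎
  where open ℚP.≤-Reasoning
pow-mono-≤ zero    _   _   = ℚP.≤-refl
pow-mono-≤ (suc n) 0≤p p<q = ℚP.<⇒≤ (pow-mono-< (suc n) 0≤p p<q)

-- The gap `pow d q - c` serves as the precision in `y ^ q ≤ c`: eventually `y ^ q` is at most
-- `pow d q`, which excludes `y > d`.
eventually-≤-root : ∀ y q c d .{{_ : NonZero q}} → 0ℚ ℚ.≤ d → c ℚ.< pow d q → y ^ q ≤ fromℚ c →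
  ∃[ N ] (∀ n → N ℕ.≤ n → seq y n ℚ.≤ d)
eventually-≤-root y q c d 0≤d c<d^q y^q≤c
  with N , h ← y^q≤c (pow d q ℚ.- c) (subst (ℚ._< pow d q ℚ.- c) (ℚP.+-inverseʳ c) (ℚP.+-monoˡ-< (ℚ.- c) c<d^q))
  = N , λ n N≤n → ℚP.≮⇒≥ λ d<y → ℚP.<-irrefl refl (begin-strict
    pow d q                   <⟨ pow-mono-< q 0≤d d<y ⟩
    pow (seq y n) q           ≡⟨ seq-^ y q n ⟨
    seq (y ^ q) n             ≤⟨ h n N≤n ⟩
    c ℚ.+ (pow d q ℚ.- c)     ≡⟨ solve 2 (λ c x → c :+ (x :- c) := x) refl c (pow d q) ⟩
    pow d q                   ∎)
  where
  open ℚP.≤-Reasoning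
  open +-*-Solver

archimedean : ∀ p → p ℚ.≤ ι ℤ.∣ ℚ.↥ p ∣
archimedean p@(mkℚ (-[1+ a ]) d-1 _) = ℚP.≤-trans (ℚP.<⇒≤ (ℚP.negative⁻¹ p)) (0≤ι (suc a))
archimedean p@(mkℚ (+ a) d-1 _) = begin
  p                              ≡⟨ ℚP.*-identityˡ p ⟨
  1ℚ ℚ.* p                       ≤⟨ ℚP.*-monoʳ-≤-nonNeg p (subst (ℚ._≤ ι (suc d-1)) ι-1 (ι-mono-≤ (s≤s z≤n))) ⟩
  ι (suc d-1) ℚ.* p              ≡⟨ cong (ι (suc d-1) ℚ.*_) (ℚP.↥p/↧p≡p p) ⟨
  ι (suc d-1) ℚ.* (+ a ℚ./ suc d-1) ≡⟨ *-/-cancel a (suc d-1) ⟩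
  ι a                            ∎
  where open ℚP.≤-Reasoning

archimedean⁻¹ : ∀ ε → 0ℚ ℚ.< ε → 1ℚ ℚ.≤ ι (ℚ.↧ₙ ε) ℚ.* ε
archimedean⁻¹ ε@(mkℚ +0 d-1 _) 0<ε = contradiction (ℚ.positive 0<ε) λ ()
archimedean⁻¹ ε@(mkℚ (-[1+ a ]) d-1 _) 0<ε = contradiction (ℚ.positive 0<ε) λ ()
archimedean⁻¹ ε@(mkℚ +[1+ a ] d-1 _) 0<ε = begin
  1ℚ                                    ≡⟨ ι-1 ⟨
  ι 1                                   ≤⟨ ι-mono-≤ (s≤s z≤n) ⟩
  ι (suc a)                             ≡⟨ *-/-cancel (suc a) (suc d-1) ⟨
  ι (suc d-1) ℚ.* (+ suc a ℚ./ suc d-1) ≡⟨ cong (ι (suc d-1) ℚ.*_) (ℚP.↥p/↧p≡p ε) ⟩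
  ι (suc d-1) ℚ.* ε                     ∎
  where open ℚP.≤-Reasoning

∃-upper-ℕ : ∀ c → ∃ λ P → NonZero P × c < fromℚ (+ P ℚ./ 1)
∃-upper-ℕ c with N , h ← cauchy c 1ℚ 0<1ℚ =
  P , _ , 1ℚ , 0<1ℚ , N , λ n N≤n → begin
    seq c n ℚ.+ 1ℚ
      ≡⟨ cong (ℚ._+ 1ℚ) (solve 2 (λ a b → a := b :+ (a :- b)) refl (seq c n) cN) ⟩
    cN ℚ.+ (seq c n ℚ.- cN) ℚ.+ 1ℚ
      ≤⟨ ℚP.+-monoˡ-≤ 1ℚ (ℚP.+-mono-≤ (archimedean cN) (ℚP.≤-trans (p≤∣p∣ _) (h n N N≤n ℕP.≤-refl))) ⟩
    ι A ℚ.+ 1ℚ ℚ.+ 1ℚ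
      ≡⟨ solve 2 (λ a o → a :+ o :+ o := o :+ (o :+ a)) refl (ι A) 1ℚ ⟩
    1ℚ ℚ.+ (1ℚ ℚ.+ ι A)
      ≡⟨ trans (ι-suc (suc A)) (cong (1ℚ ℚ.+_) (ι-suc A)) ⟨
    ι P
      ≡⟨ ι-def P ⟩
    + P ℚ./ 1 ∎
  where
  open ℚP.≤-Reasoning
  open +-*-Solver
  cN = seq c N
  A = ℤ.∣ ℚ.↥ cN ∣
  -- One unit covers the distance of later terms from `cN`, the other is the strict margin.
  P = 2 ℕ.+ A

-- `IsPower.lower` needs exponents strictly below `c`, and `c` may be 1; these approach 1 from
-- below, and together they still give `k ≤ r`.
p/[1+p]<c : ∀ c → 1ℝ ≤ c → ∀ p → fromℚ (+ p ℚ./ suc p) < c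
p/[1+p]<c c 1≤c p = e , 0<e , proj₁ eventually , λ n N≤n → begin
    g ℚ.+ e                  ≡⟨ solve 2 (λ g e → g :+ e := (g :+ (e :+ e)) :- e) refl g e ⟩
    g ℚ.+ (e ℚ.+ e) ℚ.- e    ≤⟨ ℚP.+-monoˡ-≤ (ℚ.- e) g+2e≤1 ⟩
    1ℚ ℚ.- e                 ≤⟨ ℚP.+-monoˡ-≤ (ℚ.- e) (proj₂ eventually n N≤n) ⟩
    seq c n ℚ.+ e ℚ.- e      ≡⟨ solve 2 (λ c e → c :+ e :- e := c) refl (seq c n) e ⟩
    seq c n                  ∎
  where
  open ℚP.≤-Reasoning
  open +-*-Solver
  g = + p ℚ./ suc p
  u = + 1 ℚ./ suc p
  -- Half of the gap 1/(1 + p) absorbs the slack in `1 ≤ c`; the other half is the strict margin.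
  e = ½ ℚ.* u
  0<e : 0ℚ ℚ.< e
  0<e = 0<* (ℚP.positive⁻¹ ½) (0</ 1 (suc p))
  eventually : ∃[ N ] (∀ n → N ℕ.≤ n → 1ℚ ℚ.≤ seq c n ℚ.+ e)
  eventually = 1≤c e 0<e
  g+2e≤1 : g ℚ.+ (e ℚ.+ e) ℚ.≤ 1ℚ
  g+2e≤1 = cancel-ι (suc p) (begin
    ι (suc p) ℚ.* (g ℚ.+ (e ℚ.+ e))
      ≡⟨ solve 3 (λ d g u → d :* (g :+ (con ½ :* u :+ con ½ :* u)) := d :* u :+ d :* g) refl (ι (suc p)) g u ⟩
    ι (suc p) ℚ.* u ℚ.+ ι (suc p) ℚ.* g
      ≡⟨ cong₂ ℚ._+_ (*-/-cancel 1 (suc p)) (*-/-cancel p (suc p)) ⟩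
    ι 1 ℚ.+ ι p
      ≡⟨ ι-+ 1 p ⟨
    ι (suc p)
      ≡⟨ ℚP.*-identityʳ (ι (suc p)) ⟨
    ι (suc p) ℚ.* 1ℚ ∎)

-- The fraction falls short of ½ by 1/(2v + 2). With a margin of the same size, ε ≥ 1/(1 + v)
-- suffices, and the denominator of ε is such a `v`.
∃-½-α<v/[2+2v] : ∀ α → 0ℝ < α → ∃ λ v → NonZero v × (½ℝ - α) < fromℚ (+ v ℚ./ (2 ℕ.* suc v))
∃-½-α<v/[2+2v] α (ε , 0<ε , N , h) = v , _ , e , 0</ 1 (2 ℕ.* suc v) , N , λ n N≤n → cancel-ι (2 ℕ.* suc v) (begin
    ι (2 ℕ.* suc v) ℚ.* (½ ℚ.+ (ℚ.- seq α n) ℚ.+ e)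
      ≤⟨ ℚP.*-monoˡ-≤-nonNeg (ι (2 ℕ.* suc v)) {{ℚ.nonNegative (0≤ι (2 ℕ.* suc v))}}
           (ℚP.+-monoˡ-≤ e (ℚP.+-monoʳ-≤ ½ (ℚP.neg-antimono-≤ (h n N≤n)))) ⟩
    ι (2 ℕ.* suc v) ℚ.* (½ ℚ.+ (ℚ.- (0ℚ ℚ.+ ε)) ℚ.+ e)
      ≡⟨ ℚP.*-distribˡ-+ (ι (2 ℕ.* suc v)) (½ ℚ.+ (ℚ.- (0ℚ ℚ.+ ε))) e ⟩
    ι (2 ℕ.* suc v) ℚ.* (½ ℚ.+ (ℚ.- (0ℚ ℚ.+ ε))) ℚ.+ ι (2 ℕ.* suc v) ℚ.* e
      ≡⟨ cong₂ ℚ._+_ (cong (ℚ._* (½ ℚ.+ (ℚ.- (0ℚ ℚ.+ ε)))) 2[1+v]) (trans (*-/-cancel 1 (2 ℕ.* suc v)) ι-1) ⟩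
    two ℚ.* (1ℚ ℚ.+ ι v) ℚ.* (½ ℚ.+ (ℚ.- (0ℚ ℚ.+ ε))) ℚ.+ 1ℚ
      ≡⟨ solve 2 (λ v ε → (con 1ℚ :+ con 1ℚ) :* (con 1ℚ :+ v) :* (con ½ :+ (:- (con 0ℚ :+ ε))) :+ con 1ℚ
                  := v :+ (con 1ℚ :+ con 1ℚ) :* (con 1ℚ :+ :- ((con 1ℚ :+ v) :* ε))) refl (ι v) ε ⟩
    ι v ℚ.+ two ℚ.* (1ℚ ℚ.+ ℚ.- ((1ℚ ℚ.+ ι v) ℚ.* ε))
      ≤⟨ ℚP.+-monoʳ-≤ (ι v) (ℚP.*-monoˡ-≤-nonNeg two (ℚP.+-monoʳ-≤ 1ℚ (ℚP.neg-antimono-≤ 1≤[1+v]ε))) ⟩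
    ι v ℚ.+ two ℚ.* (1ℚ ℚ.+ ℚ.- 1ℚ)
      ≡⟨ ℚP.+-identityʳ (ι v) ⟩
    ι v
      ≡⟨ *-/-cancel v (2 ℕ.* suc v) ⟨
    ι (2 ℕ.* suc v) ℚ.* (+ v ℚ./ (2 ℕ.* suc v)) ∎)
  where
  open ℚP.≤-Reasoning
  open +-*-Solver
  v = ℚ.↧ₙ ε
  e = + 1 ℚ./ (2 ℕ.* suc v)
  two = 1ℚ ℚ.+ 1ℚ
  2[1+v] : ι (2 ℕ.* suc v) ≡ two ℚ.* (1ℚ ℚ.+ ι v)
  2[1+v] = trans (ι-* 2 (suc v)) (cong₂ ℚ._*_ (trans (ι-+ 1 1) (cong₂ ℚ._+_ ι-1 ι-1)) (ι-suc v))
  1≤[1+v]ε : 1ℚ ℚ.≤ (1ℚ ℚ.+ ι v) ℚ.* ε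
  1≤[1+v]ε = begin
    1ℚ                     ≤⟨ archimedean⁻¹ ε 0<ε ⟩
    ι v ℚ.* ε              ≤⟨ ℚP.*-monoʳ-≤-nonNeg ε {{ℚ.nonNegative (ℚP.<⇒≤ 0<ε)}} (ι-mono-≤ (ℕP.n≤1+n v)) ⟩
    ι (suc v) ℚ.* ε        ≡⟨ cong (ℚ._* ε) (ι-suc v) ⟩
    (1ℚ ℚ.+ ι v) ℚ.* ε     ∎

-- Integer inequalities between `k` and `r`

module _ (k r : ℕ) {c : ℝ} (r=k^c : IsPower k c (fromℕ r)) where
  open IsPower r=k^c

  k^j≤r^[1+j] : 1ℝ ≤ c → ∀ j .{{_ : NonZero j}} → k ℕ.^ j ℕ.≤ r ℕ.^ suc j
  k^j≤r^[1+j] 1≤c j = ≤-cancel-ι {fromℕ (k ℕ.^ j)} {fromℕ r ^ suc j} (λ N → sym (ι-def (k ℕ.^ j)))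
    (λ N → trans (seq-^ (fromℕ r) (suc j) N) (trans (cong (λ x → pow x (suc j)) (sym (ι-def r))) (pow-ι r (suc j))))
    (lower j (suc j) (p/[1+p]<c c 1≤c j))

  r≤k^P : ∀ P .{{_ : NonZero P}} → c < fromℚ (+ P ℚ./ 1) → r ℕ.≤ k ℕ.^ P
  r≤k^P P c<P = ≤-cancel-ι {fromℕ r ^ 1} {fromℕ (k ℕ.^ P)} (λ N → trans (ℚP.*-identityʳ (+ r ℚ./ 1)) (sym (ι-def r)))
    (λ N → sym (ι-def (k ℕ.^ P))) (upper P 1 c<P)

-- The constant and the hard matrix for every `k`

1/ℕ*y≤ : ∀ K .{{_ : NonZero K}} y b → y ℚ.≤ ι K ℚ.* b → (+ 1 ℚ./ K) ℚ.* y ℚ.≤ b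
1/ℕ*y≤ K y b y≤Kb = cancel-ι K (begin
  ι K ℚ.* ((+ 1 ℚ./ K) ℚ.* y)    ≡⟨ ℚP.*-assoc (ι K) (+ 1 ℚ./ K) y ⟨
  ι K ℚ.* (+ 1 ℚ./ K) ℚ.* y      ≡⟨ cong (ℚ._* y) (trans (*-/-cancel 1 K) ι-1) ⟩
  1ℚ ℚ.* y                       ≡⟨ ℚP.*-identityˡ y ⟩
  y                              ≤⟨ y≤Kb ⟩
  ι K ℚ.* b                      ∎)
  where open ℚP.≤-Reasoning

-- A lower bound on the minimum over `X` is expressed as a bound for every `X`.
HardMatrix : ℝ → ℕ → ℕ → ℝ → Set
HardMatrix C k r s =
  ∃ λ (A : Matrix (k ℕ.+ 2 ℕ.^ r) r) →
    (∃ λ (Â : Matrix (k ℕ.+ 2 ℕ.^ r) r) → (rank Â ≤ k) × (‖ A -ᴹ Â ‖∞∞ ≤ 1ℝ)) ×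
    ((S : Subset r) → 2 ℕ.* ∣ S ∣ ℕ.≤ r → (X : Matrix ∣ S ∣ r) →
      (y : ℝ) → IsPower k s y → C * y ≤ ‖ A -ᴹ (A ∣ᶜ S) *ᴹ X ‖∞∞)

0^v≡0 : ∀ v .{{_ : NonZero v}} → 0 ℕ.^ v ≡ 0
0^v≡0 (suc _) = refl

module _ (v P : ℕ) .{{v≢0 : NonZero v}} .{{P≢0 : NonZero P}} where

  private
    e = 2 ℕ.* suc v
    t = 1 ℕ.+ 3 ℕ.* e ℕ.* P
    -- `8 ^ v` pays for rounding the root of `k`, and `2 + t` is the factor in `hard-norm`; neither
    -- depends on `k` or `r`.
    K = 8 ℕ.^ v ℕ.* (2 ℕ.+ t)

    instance
      K≢0 : NonZero K
      K≢0 = ℕP.m*n≢0 (8 ℕ.^ v) (2 ℕ.+ t) {{ℕP.m^n≢0 8 v}}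

  ratio : ℝ
  ratio = fromℚ (+ 1 ℚ./ K)

  0<ratio : 0ℝ < ratio
  0<ratio = + 1 ℚ./ K , 0</ 1 K , 0 , λ _ _ → ℚP.≤-reflexive (ℚP.+-identityˡ (+ 1 ℚ./ K))

  -- There are no columns, and `0 ^ v = 0` makes `y` eventually smaller than any positive rational,
  -- so nonnegativity of the norm is enough.
  hardMatrix-zero : ∀ s → s < fromℚ (+ v ℚ./ e) → HardMatrix ratio 0 0 s
  hardMatrix-zero s s<v/e = A , (fromℚᴹ (approximant w 0) , (0 , approximant-rank w 0 , z≤n) , approximant-norm w 0) ,
    bound
    where
    w : Fin 0 → Fin 0 → Fin 0
    w ()
    A : Matrix 1 0
    A = fromℚᴹ (hard w 0)
    bound : ∀ S → 2 ℕ.* ∣ S ∣ ℕ.≤ 0 → (X : Matrix ∣ S ∣ 0) → ∀ y → IsPower 0 s y →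
      ratio * y ≤ ‖ A -ᴹ (A ∣ᶜ S) *ᴹ X ‖∞∞
    bound S _ X y y=0^s ε 0<ε = proj₁ eventually , λ n N≤n →
      ℚP.≤-trans (1/ℕ*y≤ K (seq y n) ε (proj₂ eventually n N≤n))
        (subst (ℚ._≤ E n ℚ.+ ε) (ℚP.+-identityˡ ε) (ℚP.+-monoˡ-≤ ε (0≤norm (A -ᴹ (A ∣ᶜ S) *ᴹ X) n)))
      where
      E : ℕ → ℚ
      E = seq ‖ A -ᴹ (A ∣ᶜ S) *ᴹ X ‖∞∞
      0<Kε : 0ℚ ℚ.< ι K ℚ.* ε
      0<Kε = 0<* (0<ι K) 0<ε
      eventually : ∃[ N ] (∀ n → N ℕ.≤ n → seq y n ℚ.≤ ι K ℚ.* ε)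
      eventually = eventually-≤-root y e (+ (0 ℕ.^ v) ℚ./ 1) (ι K ℚ.* ε) (ℚP.<⇒≤ 0<Kε)
        (subst (ℚ._< pow (ι K ℚ.* ε) e) (sym (trans (sym (ι-def (0 ℕ.^ v))) (trans (cong ι (0^v≡0 v)) ι-0)))
          (pow-pos e 0<Kε))
        (IsPower.upper y=0^s v e s<v/e)

  -- Sizes written as `p + _` let the block matrix type-check without casts. Eventually y ≤ 8^v (1 +
  -- n) ≤ 8^v (2 + t) E = K E, with n = b^v and E a term of the norm.
  hardMatrix-code : ∀ b k r s → s < fromℚ (+ v ℚ./ e) → let p = dimension v b in
    p ℕ.+ k ℕ.< (4 ℕ.* suc b) ℕ.^ e → 2 ℕ.* p ℕ.< p ℕ.+ r →
    (∃ λ (w : Fin r → Fin (b ℕ.^ v) → Fin (2 ℕ.* b ℕ.^ v ℕ.* b)) →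
      ∀ i j → i ≢ j → agreement (w i) (w j) ℕ.≤ t) →
    HardMatrix ratio (p ℕ.+ k) (p ℕ.+ r) s
  hardMatrix-code b k r s s<v/e k< 2p<r (w , far) =
    A , (fromℚᴹ (approximant w k) , (p , approximant-rank w k , ℕP.m≤m+n p k) , approximant-norm w k) , bound
    where
    len = b ℕ.^ v
    p = dimension v b
    A : Matrix (p ℕ.+ k ℕ.+ 2 ℕ.^ (p ℕ.+ r)) (p ℕ.+ r)
    A = fromℚᴹ (hard w k)
    p<r : p ℕ.< r
    p<r = subst (ℕ._< r) (ℕP.+-identityʳ p) (ℕP.+-cancelˡ-< p (p ℕ.+ 0) r 2p<r)
    bound : ∀ S → 2 ℕ.* ∣ S ∣ ℕ.≤ p ℕ.+ r → (X : Matrix ∣ S ∣ (p ℕ.+ r)) → ∀ y → IsPower (p ℕ.+ k) s y →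
      ratio * y ≤ ‖ A -ᴹ (A ∣ᶜ S) *ᴹ X ‖∞∞
    bound S 2∣S∣≤r X y y=k^s ε 0<ε = proj₁ eventually , λ N N≤ →
      ℚP.≤-trans (1/ℕ*y≤ K (seq y N) (E N) (begin
        seq y N                                    ≤⟨ proj₂ eventually N N≤ ⟩
        ι (8 ℕ.^ v ℕ.* suc len)                      ≡⟨ ι-* (8 ℕ.^ v) (suc len) ⟩
        ι (8 ℕ.^ v) ℚ.* ι (suc len)                  ≤⟨ ℚP.*-monoˡ-≤-nonNeg (ι (8 ℕ.^ v)) {{ℚ.nonNegative (0≤ι (8 ℕ.^ v))}}
                                                        (hard-norm w k (s≤s z≤n) far S ∣S∣<r X N) ⟩
        ι (8 ℕ.^ v) ℚ.* (ι (2 ℕ.+ t) ℚ.* E N)      ≡⟨ ℚP.*-assoc (ι (8 ℕ.^ v)) (ι (2 ℕ.+ t)) (E N) ⟨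
        ι (8 ℕ.^ v) ℚ.* ι (2 ℕ.+ t) ℚ.* E N        ≡⟨ cong (ℚ._* E N) (ι-* (8 ℕ.^ v) (2 ℕ.+ t)) ⟨
        ι K ℚ.* E N                                ∎))
      (subst (ℚ._≤ E N ℚ.+ ε) (ℚP.+-identityʳ (E N)) (ℚP.+-monoʳ-≤ (E N) (ℚP.<⇒≤ 0<ε)))
      where
      open ℚP.≤-Reasoning
      E : ℕ → ℚ
      E = seq ‖ A -ᴹ (A ∣ᶜ S) *ᴹ X ‖∞∞
      ∣S∣<r : ∣ S ∣ ℕ.< r
      -- As `p < r`, half of all `p + r` columns is fewer than the `r` code columns.
      ∣S∣<r = ℕP.*-cancelˡ-< 2 ∣ S ∣ r (ℕP.≤-<-trans 2∣S∣≤r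
        (subst (p ℕ.+ r ℕ.<_) (cong (r ℕ.+_) (sym (ℕP.+-identityʳ r))) (ℕP.+-monoˡ-< r p<r)))
      eventually : ∃[ N ] (∀ n′ → N ℕ.≤ n′ → seq y n′ ℚ.≤ ι (8 ℕ.^ v ℕ.* suc len))
      eventually = eventually-≤-root y e (+ ((p ℕ.+ k) ℕ.^ v) ℚ./ 1) (ι (8 ℕ.^ v ℕ.* suc len))
        (0≤ι (8 ℕ.^ v ℕ.* suc len))
        (subst₂ ℚ._<_ (ι-def ((p ℕ.+ k) ℕ.^ v)) (sym (pow-ι (8 ℕ.^ v ℕ.* suc len) e))
          (ι-mono-< (k^v<[8^v[1+b^v]]^e v e b k<)))
        (IsPower.upper y=k^s v e s<v/e)

  hardMatrix-root : ∀ k r s → s < fromℚ (+ v ℚ./ e) → 0 ℕ.< k → k ℕ.≤ r → r ℕ.≤ k ℕ.^ P →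
    (∃ λ b → (4 ℕ.* b) ℕ.^ e ℕ.≤ k × k ℕ.< (4 ℕ.* suc b) ℕ.^ e) → HardMatrix ratio k r s
  hardMatrix-root k r s s<v/e 0<k k≤r r≤k^P (b , lo , hi) =
    split (ℕP.m≤n⇒∃[o]m+o≡n p≤k) (ℕP.m≤n⇒∃[o]m+o≡n (ℕP.≤-trans p≤k k≤r))
    where
    p = dimension v b
    2p<k : 2 ℕ.* p ℕ.< k
    2p<k = 2dimension<k v b 0<k lo
    p≤k : p ℕ.≤ k
    p≤k = ℕP.<⇒≤ (ℕP.≤-<-trans (ℕP.m≤m+n p (p ℕ.+ 0)) 2p<k)
    split : (∃ λ k′ → p ℕ.+ k′ ≡ k) → (∃ λ r′ → p ℕ.+ r′ ≡ r) → HardMatrix ratio k r s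
    -- Matching on `refl` replaces the given sizes by the sums that the block matrix requires.
    split (k′ , refl) (r′ , refl) = hardMatrix-code b k′ r′ s s<v/e hi (ℕP.<-≤-trans 2p<k k≤r)
      (∃-code-for v e P b hi (ℕP.≤-trans (ℕP.m≤n+m r′ p) r≤k^P))

  hardMatrix : ∀ k r s → s < fromℚ (+ v ℚ./ e) → k ℕ.≤ r → r ℕ.≤ k ℕ.^ P → HardMatrix ratio k r s
  hardMatrix zero r s s<v/e k≤r r≤k^P = subst (λ r → HardMatrix ratio 0 r s)
    (sym (ℕP.n≤0⇒n≡0 (subst (r ℕ.≤_) (0^v≡0 P) r≤k^P))) (hardMatrix-zero s s<v/e)
  hardMatrix k@(suc _) r s s<v/e k≤r r≤k^P = hardMatrix-root k r s s<v/e (s≤s z≤n) k≤r r≤k^P (∃-root e k)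

theorem7p7 : (α c : ℝ) → 0ℝ < α → α < ½ℝ → 1ℝ ≤ c →
    ∃[ C ] (0ℝ < C ×
    ((k r : ℕ) → IsPower k c (fromℕ r) →
    ∃ λ (A : Matrix (k ℕ.+ 2 ℕ.^ r) r) →
    (∃ λ (Â : Matrix (k ℕ.+ 2 ℕ.^ r) r) →
    (rank Â ≤ k) × (‖ A -ᴹ Â ‖∞∞ ≤ 1ℝ)) ×
    ((S : Subset r) → 2 ℕ.* ∣ S ∣ ℕ.≤ r →
    (X : Matrix ∣ S ∣ r) →
    (y : ℝ) → IsPower k (½ℝ - α) y →
    C * y ≤ ‖ A -ᴹ (A ∣ᶜ S) *ᴹ X ‖∞∞)))
theorem7p7 α c 0<α _ 1≤c = result (∃-½-α<v/[2+2v] α 0<α) (∃-upper-ℕ c)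
  where
  result : (∃ λ v → NonZero v × (½ℝ - α) < fromℚ (+ v ℚ./ (2 ℕ.* suc v))) →
           (∃ λ P → NonZero P × c < fromℚ (+ P ℚ./ 1)) →
           ∃[ C ] (0ℝ < C × (∀ k r → IsPower k c (fromℕ r) → HardMatrix C k r (½ℝ - α)))
  -- `v` comes from `α` alone and `P` from `c` alone, so `ratio` is fixed before `k` and `r`.
  result (v , v≢0 , s<v/e) (P , P≢0 , c<P) =
    ratio v P {{v≢0}} {{P≢0}} , 0<ratio v P {{v≢0}} {{P≢0}} , λ k r r=k^c →
    hardMatrix v P {{v≢0}} {{P≢0}} k r (½ℝ - α) s<v/e
      (k^j≤r^1+j⇒k≤r k r (k^j≤r^[1+j] k r r=k^c 1≤c)) (r≤k^P k r r=k^c P {{P≢0}} c<P)
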